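{- Let $\mathcal{RM}(\alpha_1,\ldots,\alpha_n)$ be a bi-rainbow meander, $n\ge 2$, and $\alpha=\sum_{\ell=1}^n\alpha_\ell$. The number $\mathcal{Z}$ of connected components satisfies the following recursion (the first applicable case is used): $$\mathcal{Z}(\alpha_1,\alpha_2,\ldots,\alpha_{n-1},\alpha_n)=\begin{cases} \mathcal{Z}(\alpha_n,\alpha_{n-1},\ldots,\alpha_2,\alpha_1), & \alpha_1>\alpha_n,\\ \mathcal{Z}(\alpha_2,\ldots,\alpha_{n-1})+\alpha_1, & \alpha_1=\alpha_n,\\ \mathcal{Z}\bigl(\mathscr{R}(\alpha_1,\alpha_n-\alpha_1),\alpha_2,\ldots,\alpha_{n-1},\alpha_n-\alpha_1+\mathscr{R}(\alpha_1,\alpha_n-\alpha_1)\bigr), & \alpha_1<\alpha_n<2\alpha_1,\\ \mathcal{Z}(\alpha_2,\ldots,\alpha_{n-1},\alpha_1), & 2\alpha_1=\alpha_n,\\ \mathcal{Z}(\alpha_2,\ldots,\alpha_{n-1},\alpha_1,\alpha_n-2\alpha_1), & 2\alpha_1<\alpha_n<\tfrac23\alpha,\\ \mathcal{Z}(\alpha_1,\alpha_2,\ldots,\alpha_{n-1}), & 2(\alpha-\alpha_n)\mid\alpha_n,\\ \mathcal{Z}\bigl(\alpha_1,\alpha_2,\ldots,\alpha_{n-1},\mathscr{R}(\alpha_n,2(\alpha-\alpha_n))\bigr), & \text{otherwise.} \end{cases}$$ Iterating this recursion gives an algorithm that determines the number $\mathcal{Z}(\alpha_1,\ldots,\alpha_n)$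 with logarithmic complexity $\mathcal{O}(b)\,\mathcal{O}(n)$, where $b=\sum_{\ell=1}^n\lceil\log_2(\alpha_\ell+1)\rceil$ is the number of bits needed to encode the input $(\alpha_1,\ldots,\alpha_n)$.
   Context: For positive integers $\alpha_1,\ldots,\alpha_n$ put $\alpha=\sum_{\ell=1}^n\alpha_\ell$. The bi-rainbow meander $\mathcal{RM}(\alpha_1,\ldots,\alpha_n)$ is the planar configuration of arcs with endpoints at the points $1,2,\ldots,2\alpha$ of the horizontal axis, defined as follows. Above the axis there are $n$ rainbow families of nested arcs: with $s_\ell=2\sum_{k<\ell}\alpha_k$, the $\ell$-th family consists of the $\alpha_\ell$ arcs joining $s_\ell+i$ with $s_\ell+2\alpha_\ell+1-i$, $i=1,\ldots,\alpha_\ell$. Below the axis there is one rainbow family of $\alpha$ nested arcs, joining $k$ with $2\alpha+1-k$, $k=1,\ldots,\alpha$. The union of all upper and lower arcs is a disjoint union of closed Jordan curves; $\mathcal{Z}(\alpha_1,\ldots,\alpha_n)$ denotes the number of these curves (connected components). Equivalently, it is the number of orbits on $\{1,\ldots,2\alpha\}$ of the group generated by the two involutions given by the upper and by the lower arcs. Conventions: $\mathcal{Z}$ of the empty tuple is $0$, and $\mathcal{Z}(\alpha_1)=\alpha_1$; the recursion terminates at tuples of length at most $1$. Zero entries in a tuple (families with no arcs) are removed. $\mathscr{R}(a,c)$ denotes the remainder of the integer division $a/c$, $0\le\mathscr{R}(a,c)<c$. Complexity is measured by counting elementary integer operations (comparison, addition, subtraction, division with remainder), each assumed to cost $\mathcal{O}(1)$;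 the cost of arithmetic with large integers is not considered. -}

module Defs where

open import Data.Bool using (Bool; if_then_else_)
open import Data.List using (List; []; _∷_; _∷ʳ_; _++_; map; upTo; reverse; filter; length; deduplicate)
open import Data.List.Membership.Propositional using (_∈_)
open import Data.List.Relation.Unary.Any using (here; there)
open import Data.Nat using (ℕ; zero; suc; _+_; _*_; _∸_; _%_; _<?_; _≟_)
open import Data.Nat.ListAction using (sum)
open import Data.Nat.Logarithm using (⌈log₂_⌉)
open import Data.Product using (_×_; _,_)
open import Data.Sum using (_⊎_; inj₁; inj₂)
open import Relation.Binary.Construct.Closure.Equivalence as EqC using (EqClosure)
open import Relation.Binary.Construct.Closure.ReflexiveTransitive using (ε; _◅_; _◅◅_)
open import Relation.Binary.Construct.Closure.Symmetric using (SymClosure; fwd; bwd)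
open import Relation.Binary.PropositionalEquality using (_≡_; refl)
open import Relation.Nullary using (Dec; does; map′; _⊎-dec_; _×-dec_)

Arc : Set
Arc = ℕ × ℕ

range : ℕ → List ℕ
range k = map suc (upTo k)

rainbow : ℕ → ℕ → List Arc
rainbow s k = map (λ i → s + i , s + 2 * k + 1 ∸ i) (range k)

upperArcsFrom : ℕ → List ℕ → List Arc
upperArcsFrom s []       = []
upperArcsFrom s (a ∷ as) = rainbow s a ++ upperArcsFrom (s + 2 * a) as

upperArcs lowerArcs meander : List ℕ → List Arc
upperArcs αs = upperArcsFrom 0 αs
lowerArcs αs = rainbow 0 (sum αs)
meander αs   = upperArcs αs ++ lowerArcs αs

Joined Connected : List Arc → ℕ → ℕ → Set
Joined arcs p q = (p , q) ∈ arcs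
Connected arcs  = EqClosure (Joined arcs)

private
  Via : List Arc → ℕ → ℕ → ℕ → ℕ → Set
  Via arcs u v p q =
    Connected arcs p q ⊎
    (Connected arcs p u × Connected arcs v q) ⊎
    (Connected arcs p v × Connected arcs u q)

  weaken : ∀ {a arcs p q} → Connected arcs p q → Connected (a ∷ arcs) p q
  weaken = EqC.map there

  via⇒connected : ∀ {arcs u v p q} → Via arcs u v p q → Connected ((u , v) ∷ arcs) p q
  via⇒connected (inj₁ pq)               = weaken pq
  via⇒connected (inj₂ (inj₁ (pu , vq))) = weaken pu ◅◅ fwd (here refl) ◅ weaken vq
  via⇒connected (inj₂ (inj₂ (pv , uq))) = weaken pv ◅◅ bwd (here refl) ◅ weaken uq

  via-step : ∀ {arcs u v p p′ q} → SymClosure (Joined arcs) p p′ →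
             Via arcs u v p′ q → Via arcs u v p q
  via-step s (inj₁ pq)               = inj₁ (s ◅ pq)
  via-step s (inj₂ (inj₁ (pu , vq))) = inj₂ (inj₁ (s ◅ pu , vq))
  via-step s (inj₂ (inj₂ (pv , uq))) = inj₂ (inj₂ (s ◅ pv , uq))

  via-new : ∀ {arcs u v q} → Via arcs u v v q → Via arcs u v u q
  via-new (inj₁ vq)               = inj₂ (inj₁ (ε , vq))
  via-new (inj₂ (inj₁ (_ , vq)))  = inj₂ (inj₁ (ε , vq))
  via-new (inj₂ (inj₂ (_ , uq)))  = inj₁ uq

  via-new′ : ∀ {arcs u v q} → Via arcs u v u q → Via arcs u v v q
  via-new′ (inj₁ uq)              = inj₂ (inj₂ (ε , uq))
  via-new′ (inj₂ (inj₁ (_ , vq))) = inj₁ vq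
  via-new′ (inj₂ (inj₂ (_ , uq))) = inj₂ (inj₂ (ε , uq))

  connected⇒via : ∀ {arcs u v p q} → Connected ((u , v) ∷ arcs) p q → Via arcs u v p q
  connected⇒via ε                        = inj₁ ε
  connected⇒via (fwd (here refl) ◅ rest) = via-new (connected⇒via rest)
  connected⇒via (bwd (here refl) ◅ rest) = via-new′ (connected⇒via rest)
  connected⇒via (fwd (there a) ◅ rest)   = via-step (fwd a) (connected⇒via rest)
  connected⇒via (bwd (there a) ◅ rest)   = via-step (bwd a) (connected⇒via rest)

connected? : ∀ arcs p q → Dec (Connected arcs p q)
connected? [] p q = map′ (λ { refl → ε }) (λ { ε → refl ; (fwd () ◅ _) ; (bwd () ◅ _) }) (p ≟ q)
connected? ((u , v) ∷ arcs) p q = map′ via⇒connected connected⇒via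
  (connected? arcs p q ⊎-dec
   (connected? arcs p u ×-dec connected? arcs v q) ⊎-dec
   (connected? arcs p v ×-dec connected? arcs u q))

-- Every curve passes through some of the points 1, …, 2α, so the curves are
-- counted by keeping one point from each connectedness class.
𝒵 : List ℕ → ℕ
𝒵 αs = length (deduplicate (connected? (meander αs)) (range (2 * sum αs)))

removeZeros : List ℕ → List ℕ
removeZeros = filter (0 <?_)

-- The clause for divisor 0 is a junk value; the recursion never divides by 0.
ℛ : ℕ → ℕ → ℕ
ℛ a zero    = a
ℛ a (suc c) = a % suc c

bits : List ℕ → ℕ
bits αs = sum (map (λ a → ⌈log₂ (a + 1) ⌉) αs)

infix 4 _costs_

record Counted (A : Set) : Set where
  constructor _costs_
  field
    value : A
    ops   : ℕ
open Counted public

return : ∀ {A} → A → Counted A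
return x = x costs 0

infixl 1 _>>=_ _>>_

_>>=_ : ∀ {A B} → Counted A → (A → Counted B) → Counted B
(x costs k) >>= f = value (f x) costs (k + ops (f x))

_>>_ : ∀ {A B} → Counted A → Counted B → Counted B
c >> d = c >>= λ _ → d

infix 5 _<!_ _=!_ _+!_ _-!_ _rem!_

_<!_ _=!_ : ℕ → ℕ → Counted Bool
x <! y = does (x <? y) costs 1
x =! y = does (x ≟ y) costs 1

_+!_ _-!_ _rem!_ : ℕ → ℕ → Counted ℕ
x +! y   = (x + y) costs 1
x -! y   = (x ∸ y) costs 1
x rem! y = ℛ x y costs 1

-- One round of the recursion on the tuple (α₁ , αs , αₙ), whose sum α is
-- carried along instead of being recomputed, since recomputing it would take
-- n additions in each round. The result consists of the sum of the new tuple,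
-- the new tuple, and the number to be added to 𝒵 of the new tuple.
-- Rearranging a tuple is not an integer operation and costs nothing.
round : (α α₁ : ℕ) (αs : List ℕ) (αₙ : ℕ) → Counted (ℕ × List ℕ × ℕ)
round α α₁ αs αₙ = do
  α₁>αₙ ← αₙ <! α₁
  if α₁>αₙ then return (α , αₙ ∷ (reverse αs ∷ʳ α₁) , 0) else do
   α₁=αₙ ← α₁ =! αₙ
   2α₁ ← α₁ +! α₁
   α-2α₁ ← α -! 2α₁
   if α₁=αₙ then return (α-2α₁ , αs , α₁) else do
    αₙ<2α₁ ← αₙ <! 2α₁
    if αₙ<2α₁ then (do
      d ← αₙ -! α₁
      r ← α₁ rem! d
      d+r ← d +! r
      old ← α₁ +! αₙ
      new ← r +! d+r
      others ← α -! old
      α′ ← others +! new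
      r=0 ← r =! 0
      return (α′ , (if r=0 then αs ∷ʳ d+r else r ∷ (αs ∷ʳ d+r)) , 0))
     else do
     2α₁=αₙ ← 2α₁ =! αₙ
     if 2α₁=αₙ then return (α-2α₁ , αs ∷ʳ α₁ , 0) else do
      2αₙ ← αₙ +! αₙ
      3αₙ ← 2αₙ +! αₙ
      2α ← α +! α
      3αₙ<2α ← 3αₙ <! 2α
      if 3αₙ<2α then (do
        αₙ-2α₁ ← αₙ -! 2α₁
        return (α-2α₁ , αs ++ α₁ ∷ αₙ-2α₁ ∷ [] , 0))
       else do
       α-αₙ ← α -! αₙ
       2[α-αₙ] ← α-αₙ +! α-αₙ
       r ← αₙ rem! 2[α-αₙ]
       r=0 ← r =! 0
       α′ ← α-αₙ +! r
       return (α′ , (if r=0 then α₁ ∷ αs else α₁ ∷ (αs ∷ʳ r)) , 0)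

-- Iterates α αs c: iterating the rounds on the tuple αs with sum α reaches a
-- tuple of length at most 1, and the whole computation is c. Each tuple
-- determines the rule that applies to it, so c is unique if it exists.
data Iterates : ℕ → List ℕ → Counted ℕ → Set where
  empty  : ∀ {α} → Iterates α [] (return 0)
  single : ∀ {α α₁} → Iterates α (α₁ ∷ []) (return α₁)
  repeat : ∀ {α α₁ αs αₙ c} →
    let (α′ , βs , k) = value (round α α₁ αs αₙ) in
    Iterates α′ βs c →
    Iterates α (α₁ ∷ (αs ∷ʳ αₙ)) (do
      _ ← round α α₁ αs αₙ
      z ← c
      z +! k)

total : List ℕ → Counted ℕ
total []       = return 0
total (a ∷ as) = do
  s ← total as
  a +! s

data Algorithm (αs : List ℕ) : Counted ℕ → Set where
  run : ∀ {c} → Iterates (value (total αs)) αs c → Algorithm αs (total αs >> c)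

{-# OPTIONS --safe #-}

-- Colour the points with two colours, constantly along the arcs. Writing ʳ for reversal, such a
-- colouring is a palindrome of the form w₁ w₁ʳ … wₙ wₙʳ with |wₗ| = αₗ, and there are 2 ^ 𝒵 of
-- them. Each case of the recursion therefore comes from a bijection between such palindromes.
--   * α₁ = αₙ: then w₁ = wₙ is arbitrary, and cancelling w₁ w₁ʳ at both ends leaves a palindrome
--     of the inner tuple.
--   * αₙ = 2α₁ + e: then wₙ = w₁ w₁ʳ y, and cancelling w₁ w₁ʳ at both ends leaves
--     w₂ w₂ʳ … w₁ w₁ʳ y yʳ. Rotating through all entries but the last subtracts 2(α − αₙ) from it.
--   * α₁ = e + d, αₙ = e + 2d: then w₁ = x y and wₙ = x y yʳ, and replacing the prefix x y yʳ and
--     its mirror image by x and xʳ leaves x xʳ … x y (x y)ʳ, which has first entry e and last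
--     entry e + d. Iterating this is the division of α₁ by αₙ − α₁.
-- For the complexity, let Φ be twice the number of bits of the tuple minus the number of bits of
-- its last entry. Every round decreases Φ except rotations and swaps of entries of comparable
-- size, and these can occur only a bounded number of times, at most the length of the tuple, in
-- succession.
module Submission where

open import Defs
open import Data.Bool using (if_then_else_; _∧_)
open import Data.Fin using (Fin; zero; combine; finToFun; funToFin) renaming (suc to fsuc)
open import Data.Fin.Properties using (injective⇒≤; finToFun-funToFin; funToFin-finToFin)
open import Data.List using (List; []; _∷_; _∷ʳ_; _++_; [_]; length; reverse; map; applyUpTo; applyDownFrom; lookup; tabulate; deduplicate; initLast; _∷ʳ′_)
open import Data.List.Membership.Propositional using (_∈_)
open import Data.List.Membership.Propositional.Properties using (∈-deduplicate⁻)
open import Data.List.Properties hiding (sum-++)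
open import Data.List.Relation.Binary.Permutation.Propositional using (↭-sym)
open import Data.List.Relation.Binary.Permutation.Propositional.Properties using (↭-reverse; map⁺; All-resp-↭)
open import Data.List.Relation.Unary.All as All using (All; []; _∷_)
import Data.List.Relation.Unary.All.Properties as Allₚ
open import Data.List.Relation.Unary.AllPairs using (AllPairs; []; _∷_)
open import Data.List.Relation.Unary.Any as Any using (Any; here; there)
import Data.List.Relation.Unary.Any.Properties as Anyₚ
open import Data.List.Relation.Unary.Unique.DecSetoid.Properties using (deduplicate-!)
open import Data.Nat using (ℕ; zero; suc; pred; _+_; _*_; _∸_; _^_; _≤_; _<_; _<?_; _≟_; z≤n; s≤s; z<s; s<s; s≤s⁻¹; s<s⁻¹)
open import Data.Nat.Divisibility using (_∣_; _∣?_; n∣m⇒m%n≡0)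
open import Data.Nat.DivMod using (_/_; m≡m%n+[m/n]*n; m%n<n)
open import Data.Nat.ListAction using (sum)
open import Data.Nat.ListAction.Properties using (sum-++; sum-↭)
open import Data.Nat.Logarithm using (⌈log₂_⌉; ⌈log₂⌉-mono-≤; ⌈log₂2*n⌉≡1+⌈log₂n⌉)
open import Data.Nat.Properties
open import Data.Nat.Tactic.RingSolver using (solve-∀)
open import Data.Product using (_×_; _,_; ∃; ∃₂; ∃-syntax; proj₁; proj₂)
open import Data.Sum using (_⊎_; inj₁; inj₂)
open import Data.Unit using (tt)
open import Function using (_∘_)
open import Relation.Binary.Bundles using (DecSetoid)
import Relation.Binary.Construct.Closure.Equivalence as EqC
open import Relation.Binary.Construct.Closure.ReflexiveTransitive using (ε; _◅_; _◅◅_)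
open import Relation.Binary.Construct.Closure.Symmetric using (fwd; bwd)
open import Relation.Binary.PropositionalEquality hiding ([_])
open import Relation.Nullary using (¬_; Dec; does; yes; no; contradiction; _×-dec_)
open import Relation.Nullary.Decidable using (dec-true; dec-false)
open import Tactic.MonoidSolver using (solve)

-- Words in two letters, and comparing exponents by injections

Letter : Set
Letter = Fin 2

Word : Set
Word = List Letter

OfLength : ℕ → Word → Set
OfLength n w = length w ≡ n

Palindrome : Word → Set
Palindrome w = reverse w ≡ w

Upper : List ℕ → Word → Set
Upper []       w = w ≡ []
Upper (a ∷ as) w = ∃₂ λ u v → w ≡ u ++ reverse u ++ v × length u ≡ a × Upper as v

Solution : List ℕ → Word → Set
Solution αs w = Upper αs w × Palindrome w

-- The image may depend on the proof of `P w`, while injectivity concludes only that the words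
-- agree. Proofs of `P` thus need not be unique, and choosing one proof for each word gives an
-- ordinary injection.
record _≼_ (P Q : Word → Set) : Set where
  field
    to        : ∀ {w} → P w → ∃ Q
    injective : ∀ {w w′} (p : P w) (p′ : P w′) → proj₁ (to p) ≡ proj₁ (to p′) → w ≡ w′

open _≼_

≼-trans : ∀ {P Q R} → P ≼ Q → Q ≼ R → P ≼ R
≼-trans f g = record
  { to        = λ p → to g (proj₂ (to f p))
  ; injective = λ p p′ eq → injective f p p′ (injective g _ _ eq)
  }

letters : ∀ {n} (w : Word) → length w ≡ n → Fin n → Letter
letters w refl = lookup w

tabulate-letters : ∀ {n} (w : Word) (eq : length w ≡ n) → tabulate (letters w eq) ≡ w
tabulate-letters w refl = tabulate-lookup w

tabulate-injective : ∀ {n} {f g : Fin n → Letter} → tabulate f ≡ tabulate g → ∀ i → f i ≡ g i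
tabulate-injective eq zero           = ∷-injectiveˡ eq
tabulate-injective eq (fsuc i) = tabulate-injective (∷-injectiveʳ eq) i

funToFin-cong : ∀ {n} {f g : Fin n → Letter} → (∀ i → f i ≡ g i) → funToFin f ≡ funToFin g
funToFin-cong {zero}  eq = refl
funToFin-cong {suc n} eq = cong₂ combine (eq zero) (funToFin-cong (eq ∘ fsuc))

-- Coding words by finite functions turns the hypothesis into an injection from `Fin (2 ^ m)` to
-- `Fin (2 ^ n)`, and powers of 2 are strictly monotone in the exponent. This is how counts of
-- solutions become statements about `𝒵`.
OfLength-reflects-≤ : ∀ {m n} → OfLength m ≼ OfLength n → m ≤ n
OfLength-reflects-≤ {m} {n} f = ≮⇒≥ λ n<m → <⇒≱ (^-monoʳ-< 2 (s≤s (s≤s z≤n)) n<m) (injective⇒≤ code-injective)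
  where
  word : Fin (2 ^ m) → ∃ (OfLength n)
  word i = to f {tabulate (finToFun {2} {m} i)} (length-tabulate (finToFun {2} {m} i))

  code : Fin (2 ^ m) → Fin (2 ^ n)
  code i = funToFin (letters (proj₁ (word i)) (proj₂ (word i)))

  code-injective : ∀ {i j} → code i ≡ code j → i ≡ j
  code-injective {i} {j} eq = begin
    i                              ≡⟨ funToFin-finToFin {m} i ⟨
    funToFin (finToFun {2} {m} i)  ≡⟨ funToFin-cong {m} (tabulate-injective (injective f {tabulate (finToFun {2} {m} i)} {tabulate (finToFun {2} {m} j)} _ _ words≡)) ⟩
    funToFin (finToFun {2} {m} j)  ≡⟨ funToFin-finToFin {m} j ⟩
    j                              ∎
    where
    open ≡-Reasoning
    letters≡ : ∀ k → letters (proj₁ (word i)) (proj₂ (word i)) k ≡ letters (proj₁ (word j)) (proj₂ (word j)) k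
    letters≡ k = trans (sym (finToFun-funToFin _ k)) (trans (cong (λ c → finToFun c k) eq) (finToFun-funToFin _ k))
    words≡ : proj₁ (word i) ≡ proj₁ (word j)
    words≡ = trans (sym (tabulate-letters _ (proj₂ (word i)))) (trans (tabulate-cong letters≡) (tabulate-letters _ (proj₂ (word j))))

-- Colourings of the points

Respects : (ℕ → Letter) → List Arc → Set
Respects c = All λ (p , q) → c p ≡ c q

respects-connected : ∀ {c arcs p q} → Respects c arcs → Connected arcs p q → c p ≡ c q
respects-connected rs ε             = refl
respects-connected rs (fwd a ◅ pq) = trans (All.lookup rs a) (respects-connected rs pq)
respects-connected rs (bwd a ◅ pq) = trans (sym (All.lookup rs a)) (respects-connected rs pq)

-- The letter of `p` is the one paired with the first entry of `rs` connected to `p`. Points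
-- connected to none get the default letter.
paint : List Arc → List ℕ → Word → ℕ → Letter
paint arcs (r ∷ rs) (x ∷ v) p = if does (connected? arcs r p) then x else paint arcs rs v p
paint arcs _        _       p = zero

-- The two ends of an arc are connected to the same points, so all tests in `paint` have the same
-- outcome for both.
paint-respects : ∀ arcs rs v → Respects (paint arcs rs v) arcs
paint-respects arcs rs v = All.tabulate (go rs v)
  where
  go : ∀ rs v {arc} → arc ∈ arcs → paint arcs rs v (proj₁ arc) ≡ paint arcs rs v (proj₂ arc)
  go []       v       a = refl
  go (r ∷ rs) []      a = refl
  go (r ∷ rs) (x ∷ v) {p , q} a with connected? arcs r p
  ... | yes rp rewrite dec-true  (connected? arcs r q) (rp ◅◅ fwd a ◅ ε) = refl
  ... | no ¬rp rewrite dec-false (connected? arcs r q) (λ rq → ¬rp (rq ◅◅ bwd a ◅ ε)) = go rs v a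

-- As the representatives are pairwise unconnected, the test against an earlier one fails and each
-- receives its own letter.
map-paint : ∀ {arcs rs v} → AllPairs (λ r s → ¬ Connected arcs r s) rs → length v ≡ length rs →
            map (paint arcs rs v) rs ≡ v
map-paint {v = []}     []        eq = refl
map-paint {arcs} {r ∷ rs} {x ∷ v} (¬rs ∷ ap) eq
  rewrite dec-true (connected? arcs r r) ε = cong (x ∷_) (trans (map-cong-local (All.map off-r ¬rs)) (map-paint ap (suc-injective eq)))
  where
  off-r : ∀ {s} → ¬ Connected arcs r s → paint arcs (r ∷ rs) (x ∷ v) s ≡ paint arcs rs v s
  off-r {s} ¬rs rewrite dec-false (connected? arcs r s) ¬rs = refl

module _ (arcs : List Arc) (ps : List ℕ) where

  representatives : List ℕ
  representatives = deduplicate (connected? arcs) ps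

  representatives-unrelated : AllPairs (λ r s → ¬ Connected arcs r s) representatives
  representatives-unrelated = deduplicate-! S ps
    where
    S : DecSetoid _ _
    S = record
      { isDecEquivalence = record
        { isEquivalence = EqC.isEquivalence (Joined arcs)
        ; _≟_ = connected? arcs
        } }

  representative : ∀ {p} → p ∈ ps → Any (Connected arcs p) representatives
  representative {p} p∈ = Anyₚ.deduplicate⁺ (connected? arcs) (λ yx px → px ◅◅ EqC.symmetric _ yx)
    (Any.map (λ { refl → ε }) p∈)

  OnPoints : Word → Set
  OnPoints w = ∃ λ c → w ≡ map c ps × Respects c arcs

  -- A colouring that respects the arcs is constant on connectedness classes, and each point of `ps`
  -- is connected to a representative. The letters at the representatives hence determine the word.
  onPoints≼ : OnPoints ≼ OfLength (length representatives)
  onPoints≼ = record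
    { to        = λ (c , _) → map c representatives , length-map c representatives
    ; injective = λ where
        (c , refl , rc) (c′ , refl , rc′) eq → map-cong-local
          (All.tabulate λ p∈ → agree rc rc′ eq (representative p∈))
    }
    where
    agree : ∀ {c c′ p rs} → Respects c arcs → Respects c′ arcs → map c rs ≡ map c′ rs →
            Any (Connected arcs p) rs → c p ≡ c′ p
    agree rc rc′ eq (here pr) = trans (respects-connected rc pr)
      (trans (∷-injectiveˡ eq) (sym (respects-connected rc′ pr)))
    agree rc rc′ eq (there a) = agree rc rc′ (∷-injectiveʳ eq) a

  -- Letters chosen freely at the representatives extend to a colouring by `paint`. They can be read
  -- back from the word, because representatives are themselves points of `ps`.
  ≼onPoints : OfLength (length representatives) ≼ OnPoints
  ≼onPoints = record
    { to        = λ {v} _ → map (paint arcs representatives v) ps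
                  , paint arcs representatives v , refl , paint-respects arcs representatives v
    ; injective = λ {v} {v′} l l′ eq → trans (sym (map-paint representatives-unrelated l))
        (trans (map-cong-local (All.tabulate λ r∈ → pointwise eq (∈-deduplicate⁻ (connected? arcs) ps r∈)))
               (map-paint representatives-unrelated l′))
    }
    where
    pointwise : ∀ {c c′ : ℕ → Letter} {ps p} → map c ps ≡ map c′ ps → p ∈ ps → c p ≡ c′ p
    pointwise eq (here refl) = ∷-injectiveˡ eq
    pointwise eq (there p∈)  = pointwise (∷-injectiveʳ eq) p∈

-- Solutions as colourings

-- The shift by `suc` is there because points are numbered from 1: these are the letters at `s + 1`,
-- ..., `s + n`.
segment : (ℕ → Letter) → ℕ → ℕ → Word
segment c s n = applyUpTo (λ i → c (s + suc i)) n

++-cancel-length : ∀ {A : Set} (u u′ : List A) {v v′} → length u ≡ length u′ → u ++ v ≡ u′ ++ v′ → u ≡ u′ × v ≡ v′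
++-cancel-length []      []        l eq = refl , eq
++-cancel-length (x ∷ u) (x′ ∷ u′) l eq =
  let u≡ , v≡ = ++-cancel-length u u′ (suc-injective l) (∷-injectiveʳ eq)
  in cong₂ _∷_ (∷-injectiveˡ eq) u≡ , v≡

splitLength : ∀ {A : Set} m {n} (w : List A) → length w ≡ m + n →
              ∃₂ λ u v → w ≡ u ++ v × length u ≡ m × length v ≡ n
splitLength zero    w       l = [] , w , refl , refl , l
splitLength (suc m) (x ∷ w) l =
  let u , v , w≡ , lu , lv = splitLength m w (suc-injective l)
  in x ∷ u , v , cong (x ∷_) w≡ , cong suc lu , lv

applyUpTo-++ : ∀ {A : Set} (f : ℕ → A) m n → applyUpTo f (m + n) ≡ applyUpTo f m ++ applyUpTo (λ i → f (m + i)) n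
applyUpTo-++ f zero    n = refl
applyUpTo-++ f (suc m) n = cong (f 0 ∷_) (applyUpTo-++ (f ∘ suc) m n)

applyUpTo-cong : ∀ {A : Set} {f g : ℕ → A} n → (∀ i → i < n → f i ≡ g i) → applyUpTo f n ≡ applyUpTo g n
applyUpTo-cong zero    eq = refl
applyUpTo-cong (suc n) eq = cong₂ _∷_ (eq 0 z<s) (applyUpTo-cong n (λ i i<n → eq (suc i) (s<s i<n)))

applyUpTo-injective : ∀ {A : Set} {f g : ℕ → A} n → applyUpTo f n ≡ applyUpTo g n → ∀ i → i < n → f i ≡ g i
applyUpTo-injective (suc n) eq zero    i<n = ∷-injectiveˡ eq
applyUpTo-injective (suc n) eq (suc i) i<n = applyUpTo-injective n (∷-injectiveʳ eq) i (s<s⁻¹ i<n)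

applyDownFrom≡applyUpTo : ∀ {A : Set} (f : ℕ → A) n → applyDownFrom f n ≡ applyUpTo (λ i → f (n ∸ suc i)) n
applyDownFrom≡applyUpTo f zero    = refl
applyDownFrom≡applyUpTo f (suc n) = cong (f n ∷_) (applyDownFrom≡applyUpTo f n)

segment-++ : ∀ c s m n → segment c s (m + n) ≡ segment c s m ++ segment c (s + m) n
segment-++ c s m n = trans (applyUpTo-++ _ m n)
  (cong (segment c s m ++_) (applyUpTo-cong n λ i _ → cong c (trans (cong (s +_) (sym (+-suc m i))) (sym (+-assoc s m (suc i))))))

length-segment : ∀ c s n → length (segment c s n) ≡ n
length-segment c s n = length-applyUpTo _ n

map-range : ∀ {A : Set} (f : ℕ → A) n → map f (range n) ≡ applyUpTo (f ∘ suc) n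
map-range f n = trans (sym (map-∘ _)) (map-upTo (f ∘ suc) n)

-- Matches the two numberings: the position mirror to `i` in a block, counted from 0, is the right
-- end of the arc that starts at `s + suc i`.
mirror : ∀ s k i → i < 2 * k → s + suc (2 * k ∸ suc i) ≡ s + 2 * k + 1 ∸ suc i
mirror s k i i<2k = begin
  s + suc (2 * k ∸ suc i)  ≡⟨ cong (s +_) (+-∸-assoc 1 i<2k) ⟨
  s + (2 * k ∸ i)          ≡⟨ +-∸-assoc s (<⇒≤ i<2k) ⟨
  s + 2 * k ∸ i            ≡⟨ cong (_∸ suc i) (+-comm 1 (s + 2 * k)) ⟩
  s + 2 * k + 1 ∸ suc i    ∎
  where open ≡-Reasoning

module _ (c : ℕ → Letter) (s k : ℕ) where
  private
    f : ℕ → Letter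
    f i = c (s + suc i)

    reverse-segment : reverse (segment c s (2 * k)) ≡ applyUpTo (λ i → f (2 * k ∸ suc i)) (2 * k)
    reverse-segment = trans (reverse-applyUpTo f (2 * k)) (applyDownFrom≡applyUpTo f (2 * k))

    k≤2k : k ≤ 2 * k
    k≤2k = m≤m+n k _

  respects-rainbow⇒palindrome : Respects c (rainbow s k) → Palindrome (segment c s (2 * k))
  respects-rainbow⇒palindrome rs = trans reverse-segment (applyUpTo-cong (2 * k) symmetric)
    where
    low : ∀ i → i < k → f i ≡ f (2 * k ∸ suc i)
    low i i<k = trans
      (Allₚ.applyUpTo⁻ _ k (subst (Respects c) (map-range _ k) rs) i<k)
      (cong c (sym (mirror s k i (≤-trans i<k k≤2k))))

    symmetric : ∀ i → i < 2 * k → f (2 * k ∸ suc i) ≡ f i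
    symmetric i i<2k with i <? k
    ... | yes i<k = sym (low i i<k)
    -- A position in the right half is reflected into the left half, where the arcs apply, and
    -- reflected back.
    ... | no  i≮k = trans (low (2 * k ∸ suc i) j<k) (cong f i≡)
      where
      j<k : 2 * k ∸ suc i < k
      j<k = begin-strict
        2 * k ∸ suc i  <⟨ ∸-monoʳ-< (n<1+n i) i<2k ⟩
        2 * k ∸ i      ≤⟨ ∸-monoʳ-≤ (2 * k) (≮⇒≥ i≮k) ⟩
        2 * k ∸ k      ≡⟨ m+n∸m≡n k (k + 0) ⟩
        k + 0          ≡⟨ +-identityʳ k ⟩
        k              ∎
        where open ≤-Reasoning

      i≡ : 2 * k ∸ suc (2 * k ∸ suc i) ≡ i
      i≡ = trans (cong (2 * k ∸_) (sym (+-∸-assoc 1 i<2k))) (m∸[m∸n]≡n (<⇒≤ i<2k))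

  palindrome⇒respects-rainbow : Palindrome (segment c s (2 * k)) → Respects c (rainbow s k)
  palindrome⇒respects-rainbow pal = subst (Respects c) (sym (map-range _ k)) (Allₚ.applyUpTo⁺₁ _ k λ {i} i<k →
    let i<2k = ≤-trans i<k k≤2k in
    trans (sym (applyUpTo-injective (2 * k) (trans (sym reverse-segment) pal) i i<2k)) (cong c (mirror s k i i<2k)))

length-reverse-++ : ∀ (u : Word) → length (u ++ reverse u) ≡ 2 * length u
length-reverse-++ u = trans (length-++ u) (cong (length u +_) (trans (length-reverse u) (sym (+-identityʳ _))))

palindrome-double : ∀ u → Palindrome (u ++ reverse u)
palindrome-double u = trans (reverse-++ u (reverse u)) (cong (_++ reverse u) (reverse-involutive u))

halve : ∀ k {w} → length w ≡ 2 * k → Palindrome w → ∃ λ u → w ≡ u ++ reverse u × length u ≡ k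
halve k {w} l pal with splitLength k w l
... | u , v , refl , lu , lv = u , cong (u ++_) v≡ , lu
  where
  v≡ : v ≡ reverse u
  v≡ = sym (proj₂ (++-cancel-length (reverse v) u
         (trans (length-reverse v) (trans lv (trans (+-identityʳ k) (sym lu))))
         (trans (sym (reverse-++ u v)) pal)))

respects⇒upper : ∀ c s αs → Respects c (upperArcsFrom s αs) → Upper αs (segment c s (2 * sum αs))
respects⇒upper c s []       rs = refl
respects⇒upper c s (a ∷ as) rs =
  let rs₁ , rs₂    = Allₚ.++⁻ (rainbow s a) rs
      u , seg≡ , l = halve a (length-segment c s (2 * a)) (respects-rainbow⇒palindrome c s a rs₁)
  in u , _
   , trans (cong (segment c s) (*-distribˡ-+ 2 a (sum as)))
     (trans (segment-++ c s (2 * a) (2 * sum as))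
     (trans (cong (_++ _) seg≡) (++-assoc u (reverse u) _)))
   , l , respects⇒upper c (s + 2 * a) as rs₂

upper⇒respects : ∀ c s αs → Upper αs (segment c s (2 * sum αs)) → Respects c (upperArcsFrom s αs)
upper⇒respects c s []       up = []
upper⇒respects c s (a ∷ as) (u , v , seg≡ , l , up) =
  Allₚ.++⁺ (palindrome⇒respects-rainbow c s a (subst Palindrome (proj₁ cut) (palindrome-double u)))
           (upper⇒respects c (s + 2 * a) as (subst (Upper as) (proj₂ cut) up))
  where
  cut : u ++ reverse u ≡ segment c s (2 * a) × v ≡ segment c (s + 2 * a) (2 * sum as)
  cut = ++-cancel-length (u ++ reverse u) _
    (trans (length-reverse-++ u) (trans (cong (2 *_) l) (sym (length-segment c s (2 * a)))))
    (trans (++-assoc u (reverse u) v) (trans (sym seg≡)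
    (trans (cong (segment c s) (*-distribˡ-+ 2 a (sum as))) (segment-++ c s (2 * a) (2 * sum as)))))

nth : Word → ℕ → Letter
nth []      _       = zero
nth (x ∷ w) zero    = x
nth (x ∷ w) (suc i) = nth w i

applyUpTo-nth : ∀ w → applyUpTo (nth w) (length w) ≡ w
applyUpTo-nth []      = refl
applyUpTo-nth (x ∷ w) = cong (x ∷_) (applyUpTo-nth w)

length-upper : ∀ αs {w} → Upper αs w → length w ≡ 2 * sum αs
length-upper []       refl = refl
length-upper (a ∷ as) (u , v , refl , l , up) = begin
  length (u ++ reverse u ++ v)       ≡⟨ cong length (++-assoc u (reverse u) v) ⟨
  length ((u ++ reverse u) ++ v)     ≡⟨ length-++ (u ++ reverse u) ⟩
  length (u ++ reverse u) + length v ≡⟨ cong₂ _+_ (trans (length-reverse-++ u) (cong (2 *_) l)) (length-upper as up) ⟩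
  2 * a + 2 * sum as                 ≡⟨ *-distribˡ-+ 2 a (sum as) ⟨
  2 * (a + sum as)                   ∎
  where open ≡-Reasoning

solution≼ : ∀ αs → Solution αs ≼ OfLength (𝒵 αs)
solution≼ αs = ≼-trans
  (record { to = λ sol → _ , colouring sol ; injective = λ _ _ eq → eq })
  (onPoints≼ (meander αs) (range (2 * sum αs)))
  where
  colouring : ∀ {w} → Solution αs w → OnPoints (meander αs) (range (2 * sum αs)) w
  colouring {w} (up , pal) = c , trans (sym seg≡) (sym (map-range c (2 * sum αs)))
    , Allₚ.++⁺ (upper⇒respects c 0 αs (subst (Upper αs) (sym seg≡) up))
               (palindrome⇒respects-rainbow c 0 (sum αs) (subst Palindrome (sym seg≡) pal))
    where
    c : ℕ → Letter
    -- Points are numbered from 1, positions in a word from 0.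
    c p = nth w (pred p)
    seg≡ : segment c 0 (2 * sum αs) ≡ w
    seg≡ = trans (cong (segment c 0) (sym (length-upper αs up))) (applyUpTo-nth w)

≼solution : ∀ αs → OfLength (𝒵 αs) ≼ Solution αs
≼solution αs = ≼-trans
  (≼onPoints (meander αs) (range (2 * sum αs)))
  (record { to = λ on → _ , solution on ; injective = λ _ _ eq → eq })
  where
  solution : ∀ {w} → OnPoints (meander αs) (range (2 * sum αs)) w → Solution αs w
  solution (c , refl , rs) with Allₚ.++⁻ (upperArcs αs) rs
  ... | rs₁ , rs₂ = subst (Solution αs) (sym (map-range c (2 * sum αs)))
    (respects⇒upper c 0 αs rs₁ , respects-rainbow⇒palindrome c 0 (sum αs) rs₂)

-- Solutions of a tuple are in bijection-size with words of length `𝒵`, so injections both ways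
-- force equal exponents; no inverse has to be exhibited.
𝒵-cong : ∀ {αs βs} → Solution αs ≼ Solution βs → Solution βs ≼ Solution αs → 𝒵 αs ≡ 𝒵 βs
𝒵-cong {αs} {βs} f g = ≤-antisym
  (OfLength-reflects-≤ (≼-trans (≼solution αs) (≼-trans f (solution≼ βs))))
  (OfLength-reflects-≤ (≼-trans (≼solution βs) (≼-trans g (solution≼ αs))))

-- Reductions of solutions

≼-cong : ∀ {P Q : Word → Set} → (∀ {w} → P w → Q w) → P ≼ Q
≼-cong f = record { to = λ {w} p → w , f p ; injective = λ _ _ eq → eq }

-- Words of `P` and of `Q` are described by the same parameters. Instead of injectivity of `φ` or
-- `ψ`, it suffices that `ψ` determines the word `φ`. Exchanging the roles of `φ` and `ψ` gives the
-- opposite direction.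
reparametrise : ∀ {P Q : Word → Set} {I : Set} (φ ψ : I → Word) →
                (∀ {w} → P w → ∃ λ i → w ≡ φ i) → (∀ i → Q (ψ i)) →
                (∀ {i j} → ψ i ≡ ψ j → φ i ≡ φ j) → P ≼ Q
reparametrise φ ψ parse sound transfer = record
  { to        = λ p → ψ (proj₁ (parse p)) , sound (proj₁ (parse p))
  ; injective = λ p p′ eq → trans (proj₂ (parse p)) (trans (transfer eq) (sym (proj₂ (parse p′))))
  }

upper-++⁺ : ∀ as {bs u v} → Upper as u → Upper bs v → Upper (as ++ bs) (u ++ v)
upper-++⁺ []       refl up′ = up′
upper-++⁺ (a ∷ as) {v = v} (u , u′ , refl , l , up) up′ = u , u′ ++ v
  , trans (++-assoc u (reverse u ++ u′) v) (cong (u ++_) (++-assoc (reverse u) u′ v))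
  , l , upper-++⁺ as up up′

upper-++⁻ : ∀ as {bs w} → Upper (as ++ bs) w → ∃₂ λ u v → w ≡ u ++ v × Upper as u × Upper bs v
upper-++⁻ []       up = [] , _ , refl , refl , up
upper-++⁻ (a ∷ as) (u , _ , refl , l , up) with upper-++⁻ as up
... | u′ , v , refl , up₁ , up₂ = u ++ reverse u ++ u′ , v
  , sym (trans (++-assoc u (reverse u ++ u′) v) (cong (u ++_) (++-assoc (reverse u) u′ v)))
  , (u , u′ , refl , l , up₁) , up₂

upper-[_] : ∀ u → Upper [ length u ] (u ++ reverse u)
upper-[ u ] = u , [] , cong (u ++_) (sym (++-identityʳ (reverse u))) , refl , refl

-- Each block is a palindrome, so reversing the word only reverses the order of the blocks. A
-- solution is itself a palindrome, hence the very same word solves the reversed tuple.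
upper-reverse : ∀ as {w} → Upper as w → Upper (reverse as) (reverse w)
upper-reverse []       refl = refl
upper-reverse (a ∷ as) (u , v , refl , refl , up) =
  subst₂ Upper (sym (unfold-reverse a as)) reversed (upper-++⁺ (reverse as) (upper-reverse as up) upper-[ u ])
  where
  reversed : reverse v ++ u ++ reverse u ≡ reverse (u ++ reverse u ++ v)
  reversed = begin
    reverse v ++ u ++ reverse u              ≡⟨ cong (reverse v ++_) (palindrome-double u) ⟨
    reverse v ++ reverse (u ++ reverse u)    ≡⟨ reverse-++ (u ++ reverse u) v ⟨
    reverse ((u ++ reverse u) ++ v)          ≡⟨ cong reverse (++-assoc u (reverse u) v) ⟩
    reverse (u ++ reverse u ++ v)            ∎
    where open ≡-Reasoning

solution-reverse : ∀ {αs w} → Solution αs w → Solution (reverse αs) w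
solution-reverse {αs} (up , pal) = subst (Upper (reverse αs)) pal (upper-reverse αs up) , pal

𝒵-reverse : ∀ αs → 𝒵 αs ≡ 𝒵 (reverse αs)
𝒵-reverse αs = 𝒵-cong (≼-cong solution-reverse)
  (≼-cong λ {w} sol → subst (λ βs → Solution βs w) (reverse-involutive αs) (solution-reverse sol))

module _ (u v : Word) where
  private
    reverse-framed : reverse (u ++ v ++ reverse u) ≡ u ++ reverse v ++ reverse u
    reverse-framed = begin
      reverse (u ++ v ++ reverse u)                  ≡⟨ reverse-++ u (v ++ reverse u) ⟩
      reverse (v ++ reverse u) ++ reverse u          ≡⟨ cong (_++ reverse u) (reverse-++ v (reverse u)) ⟩
      (reverse (reverse u) ++ reverse v) ++ reverse u ≡⟨ cong (λ x → (x ++ reverse v) ++ reverse u) (reverse-involutive u) ⟩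
      (u ++ reverse v) ++ reverse u                  ≡⟨ ++-assoc u (reverse v) (reverse u) ⟩
      u ++ reverse v ++ reverse u                    ∎
      where open ≡-Reasoning

  frame : Palindrome v → Palindrome (u ++ v ++ reverse u)
  frame pal = trans reverse-framed (cong (λ x → u ++ x ++ reverse u) pal)

  unframe : Palindrome (u ++ v ++ reverse u) → Palindrome v
  unframe pal = ++-cancelʳ (reverse u) _ _ (++-cancelˡ u _ _ (trans (sym reverse-framed) pal))

-- Words with a distinguished first and last block

ends : Word → Word → Word → Word
ends u v w = u ++ reverse u ++ v ++ w ++ reverse w

-- For a palindrome, this exhibits the word with its last block in front, so that the last
-- half-block can be compared letter by letter with the beginning of the word.
reverse-ends : ∀ u v w → reverse (ends u v w) ≡ ends w (reverse v) u
reverse-ends u v w = begin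
  reverse (u ++ reverse u ++ v ++ w ++ reverse w)
    ≡⟨ cong reverse (++-assoc u (reverse u) (v ++ w ++ reverse w)) ⟨
  reverse ((u ++ reverse u) ++ v ++ (w ++ reverse w))
    ≡⟨ reverse-++ (u ++ reverse u) _ ⟩
  reverse (v ++ (w ++ reverse w)) ++ reverse (u ++ reverse u)
    ≡⟨ cong₂ _++_ (reverse-++ v (w ++ reverse w)) (palindrome-double u) ⟩
  (reverse (w ++ reverse w) ++ reverse v) ++ (u ++ reverse u)
    ≡⟨ cong (λ x → (x ++ reverse v) ++ (u ++ reverse u)) (palindrome-double w) ⟩
  ((w ++ reverse w) ++ reverse v) ++ (u ++ reverse u)
    ≡⟨ solve (++-monoid Letter) ⟩
  w ++ reverse w ++ reverse v ++ u ++ reverse u ∎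
  where open ≡-Reasoning

upper-ends⁻ : ∀ a αs b {w} → Upper (a ∷ (αs ∷ʳ b)) w →
              ∃ λ u → ∃₂ λ v x → w ≡ ends u v x × length u ≡ a × Upper αs v × length x ≡ b
upper-ends⁻ a αs b (u , _ , refl , lu , up) with upper-++⁻ αs up
... | v , _ , refl , up′ , x , _ , refl , lx , refl =
  u , v , x , cong (λ y → u ++ reverse u ++ v ++ x ++ y) (++-identityʳ (reverse x)) , lu , up′ , lx

upper-ends⁺ : ∀ αs {u v x} → Upper αs v → Upper (length u ∷ (αs ∷ʳ length x)) (ends u v x)
upper-ends⁺ αs {u} {v} {x} up = u , v ++ x ++ reverse x , refl , refl , upper-++⁺ αs up upper-[ x ]

module EqualEnds (a : ℕ) (αs : List ℕ) where

  parse : ∀ {w} → Solution (a ∷ (αs ∷ʳ a)) w → ∃₂ λ u v → w ≡ ends u v u × length u ≡ a × Solution αs v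
  parse {w} (up , pal) with upper-ends⁻ a αs a up
  ... | u , v , x , refl , lu , upv , lx
    -- By palindromicity the word starts with `x` as well as with `u`, and these have the same
    -- length.
    with ++-cancel-length x u (trans lx (sym lu)) (trans (sym (reverse-ends u v x)) pal)
  ... | refl , _ = u , v , refl , lu , upv
    , unframe (u ++ reverse u) v (subst Palindrome framed pal)
    where
    framed : ends u v u ≡ (u ++ reverse u) ++ v ++ reverse (u ++ reverse u)
    framed rewrite palindrome-double u = solve (++-monoid Letter)

  solution : ∀ {u v} → length u ≡ a → Solution αs v → Solution (a ∷ (αs ∷ʳ a)) (ends u v u)
  solution {u} {v} refl (up , pal) = upper-ends⁺ αs {u} {v} {u} up , trans (reverse-ends u v u) (cong (λ x → ends u x u) pal)

  ends-injective : ∀ {u u′ v v′} → length u ≡ a → length u′ ≡ a → ends u v u ≡ ends u′ v′ u′ → u ≡ u′ × v ≡ v′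
  ends-injective {u} {u′} lu lu′ eq with ++-cancel-length u u′ (trans lu (sym lu′)) eq
  ... | refl , eq′ = refl , ++-cancelʳ (u ++ reverse u) _ _ (++-cancelˡ (reverse u) _ _ eq′)

  -- The inner solution is coded by `𝒵 αs` letters, and the common half-block `u` contributes `a`
  -- free letters.
  solution≼length : Solution (a ∷ (αs ∷ʳ a)) ≼ OfLength (𝒵 αs + a)
  solution≼length = record { to = λ sol → _ , proj₂ (encode (parse sol)) ; injective = λ sol sol′ → inj (parse sol) (parse sol′) }
    where
    encode : ∀ {w} → (∃₂ λ u v → w ≡ ends u v u × length u ≡ a × Solution αs v) → ∃ (OfLength (𝒵 αs + a))
    encode (u , v , _ , lu , sol) =
      let x , lx = to (solution≼ αs) sol
      in x ++ u , trans (length-++ x) (cong₂ _+_ lx lu)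

    inj : ∀ {w w′} p p′ → proj₁ (encode {w} p) ≡ proj₁ (encode {w′} p′) → w ≡ w′
    inj (u , v , refl , lu , sol) (u′ , v′ , refl , lu′ , sol′) eq
      with ++-cancel-length (proj₁ (to (solution≼ αs) sol)) (proj₁ (to (solution≼ αs) sol′)) {u} {u′}
             (trans (proj₂ (to (solution≼ αs) sol)) (sym (proj₂ (to (solution≼ αs) sol′)))) eq
    ... | x≡ , refl with injective (solution≼ αs) sol sol′ x≡
    ... | refl = refl

  length≼solution : OfLength (𝒵 αs + a) ≼ Solution (a ∷ (αs ∷ʳ a))
  length≼solution = record
    { to = λ {w} l → _ , proj₂ (decode (splitLength (𝒵 αs) w l))
    ; injective = λ {w} {w′} l l′ → inj (splitLength (𝒵 αs) w l) (splitLength (𝒵 αs) w′ l′) }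
    where
    decode : ∀ {w} → (∃₂ λ x u → w ≡ x ++ u × length x ≡ 𝒵 αs × length u ≡ a) → ∃ (Solution (a ∷ (αs ∷ʳ a)))
    decode (x , u , _ , lx , lu) = _ , solution {u} lu (proj₂ (to (≼solution αs) {x} lx))

    inj : ∀ {w w′} p p′ → proj₁ (decode {w} p) ≡ proj₁ (decode {w′} p′) → w ≡ w′
    inj (x , u , refl , lx , lu) (x′ , u′ , refl , lx′ , lu′) eq 
      with ends-injective {u} {u′} {proj₁ (to (≼solution αs) {x} lx)} {proj₁ (to (≼solution αs) {x′} lx′)} lu lu′ eq
    ... | refl , v≡ = cong (_++ u) (injective (≼solution αs) {x} {x′} lx lx′ v≡)

𝒵-equalEnds : ∀ a αs → 𝒵 (a ∷ (αs ∷ʳ a)) ≡ 𝒵 αs + a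
𝒵-equalEnds a αs = ≤-antisym
  (OfLength-reflects-≤ (≼-trans (≼solution (a ∷ (αs ∷ʳ a))) solution≼length))
  (OfLength-reflects-≤ (≼-trans length≼solution (solution≼ (a ∷ (αs ∷ʳ a)))))
  where open EqualEnds a αs

length-upper-cong : ∀ αs {u v} → Upper αs u → Upper αs v → length u ≡ length v
length-upper-cong αs up up′ = trans (length-upper αs up) (sym (length-upper αs up′))

module Slide (d e : ℕ) (αs : List ℕ) where

  -- The palindrome common to both tuples: framing it by x y yʳ gives a solution of the larger one,
  -- framing it by x a solution of the smaller one.
  core : Word → Word → Word → Word
  core x y v = reverse x ++ v ++ x ++ y ++ reverse y

  record Parameters : Set where
    constructor parameters
    field
      x y v      : Word
      length-x   : length x ≡ e
      length-y   : length y ≡ d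
      upper      : Upper αs v
      palindrome : Palindrome (core x y v)
  open Parameters

  long short : Word → Word → Word → Word
  long  x y v = (x ++ y ++ reverse y) ++ core x y v ++ reverse (x ++ y ++ reverse y)
  short x y v = x ++ core x y v ++ reverse x

  long-ends : ∀ x y v → ends (x ++ y) v (x ++ y ++ reverse y) ≡ long x y v
  long-ends x y v rewrite reverse-++ x y | reverse-++ x (y ++ reverse y) | palindrome-double y =
    solve (++-monoid Letter)

  short-ends : ∀ x y v → ends x v (x ++ y) ≡ short x y v
  short-ends x y v rewrite reverse-++ x y = solve (++-monoid Letter)

  φ ψ : Parameters → Word
  φ p = long (x p) (y p) (v p)
  ψ p = short (x p) (y p) (v p)

  cong-parameters : ∀ {x x′ y y′ v v′} (f : Word → Word → Word → Word) → x ≡ x′ × y ≡ y′ × v ≡ v′ → f x y v ≡ f x′ y′ v′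
  cong-parameters f (refl , refl , refl) = refl

  core-injective : ∀ p q → x p ≡ x q → core (x p) (y p) (v p) ≡ core (x q) (y q) (v q) → y p ≡ y q × v p ≡ v q
  core-injective p q refl eq
    with ++-cancel-length (v p) (v q) (length-upper-cong αs (upper p) (upper q)) (++-cancelˡ (reverse (x p)) _ _ eq)
  ... | v≡ , eq′ = proj₁ (++-cancel-length (y p) (y q) (trans (length-y p) (sym (length-y q))) (++-cancelˡ (x p) _ _ eq′)) , v≡

  framed-injective : ∀ {u u′ v v′ : Word} → length u ≡ length u′ → u ++ v ++ reverse u ≡ u′ ++ v′ ++ reverse u′ → u ≡ u′ × v ≡ v′
  framed-injective {u} {u′} l eq with ++-cancel-length u u′ l eq
  ... | refl , eq′ = refl , ++-cancelʳ (reverse u) _ _ eq′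

  ψ⇒φ : ∀ {p q} → ψ p ≡ ψ q → φ p ≡ φ q
  ψ⇒φ {p} {q} eq with framed-injective (trans (length-x p) (sym (length-x q))) eq
  ... | x≡ , core≡ = cong-parameters long (x≡ , core-injective p q x≡ core≡)

  φ⇒ψ : ∀ {p q} → φ p ≡ φ q → ψ p ≡ ψ q
  φ⇒ψ {p} {q} eq with framed-injective lengths eq
    where
    lengths : length (x p ++ y p ++ reverse (y p)) ≡ length (x q ++ y q ++ reverse (y q))
    lengths = trans (length-++ (x p)) (trans (cong₂ _+_ (trans (length-x p) (sym (length-x q)))
      (trans (length-reverse-++ (y p)) (trans (cong (2 *_) (trans (length-y p) (sym (length-y q)))) (sym (length-reverse-++ (y q))))))
      (sym (length-++ (x q))))
  ... | prefix≡ , core≡ with ++-cancel-length (x p) (x q) (trans (length-x p) (sym (length-x q))) prefix≡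
  ... | x≡ , _ = cong-parameters short (x≡ , core-injective p q x≡ core≡)

  parse-long : ∀ {w} → Solution (e + d ∷ (αs ∷ʳ (e + (d + d)))) w → ∃ λ p → w ≡ φ p
  parse-long {w} (up , pal) with upper-ends⁻ (e + d) αs (e + (d + d)) up
  ... | a , v , b , refl , la , upv , lb with splitLength e a la | splitLength e b lb
  ... | x , y , refl , lx , ly | x′ , yz′ , refl , lx′ , lyz with splitLength d yz′ lyz
  ... | y′ , z′ , refl , ly′ , lz′
    -- The first block is x y yʳ xʳ, longer than the last half-block, which the palindrome places at
    -- the front. So that half-block is x y yʳ.
    with ++-cancel-length (x′ ++ y′ ++ z′) (x ++ y ++ reverse y) lengths
           (trans (sym (reverse-ends (x ++ y) v (x′ ++ y′ ++ z′))) (trans pal (unfold (x′ ++ y′ ++ z′))))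
    where
    unfold : ∀ b → ends (x ++ y) v b ≡ (x ++ y ++ reverse y) ++ (reverse x ++ v ++ b ++ reverse b)
    unfold b rewrite reverse-++ x y = solve (++-monoid Letter)
    lengths : length (x′ ++ y′ ++ z′) ≡ length (x ++ y ++ reverse y)
    lengths = trans lb (sym (trans (length-++ x) (cong₂ _+_ lx (trans (length-++ y) (cong₂ _+_ ly (trans (length-reverse y) ly))))))
  ... | b≡ , _ rewrite b≡ = parameters x y v lx ly upv
      (unframe (x ++ y ++ reverse y) (core x y v) (subst Palindrome (long-ends x y v) pal))
    , long-ends x y v

  parse-short : ∀ {w} → Solution (e ∷ (αs ∷ʳ (e + d))) w → ∃ λ p → w ≡ ψ p
  parse-short {w} (up , pal) with upper-ends⁻ e αs (e + d) up
  ... | x , v , b , refl , lx , upv , lb with splitLength e b lb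
  ... | x′ , y , refl , lx′ , ly
    with ++-cancel-length x′ x (trans lx′ (sym lx))
           (trans (sym (++-assoc x′ y _)) (trans (sym (reverse-ends x v (x′ ++ y))) pal))
  ... | refl , _ = parameters x y v lx ly upv
      (unframe x (core x y v) (subst Palindrome (short-ends x y v) pal))
    , short-ends x y v

  sound-long : ∀ p → Solution (e + d ∷ (αs ∷ʳ (e + (d + d)))) (φ p)
  sound-long (parameters x y v refl refl up pal) =
    subst₂ Upper (cong₂ (λ a b → a ∷ (αs ∷ʳ b)) (length-++ x)
                   (trans (length-++ x) (cong (length x +_) (trans (length-++ y) (cong (length y +_) (length-reverse y))))))
      (long-ends x y v) (upper-ends⁺ αs {x ++ y} {v} {x ++ y ++ reverse y} up)
    , frame (x ++ y ++ reverse y) (core x y v) pal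

  sound-short : ∀ p → Solution (e ∷ (αs ∷ʳ (e + d))) (ψ p)
  sound-short (parameters x y v refl refl up pal) =
    subst₂ Upper (cong (λ b → length x ∷ (αs ∷ʳ b)) (length-++ x)) (short-ends x y v) (upper-ends⁺ αs {x} {v} {x ++ y} up)
    , frame x (core x y v) pal

𝒵-slide : ∀ d e αs → 𝒵 (e + d ∷ (αs ∷ʳ (e + (d + d)))) ≡ 𝒵 (e ∷ (αs ∷ʳ (e + d)))
𝒵-slide d e αs = 𝒵-cong
  (reparametrise φ ψ parse-long sound-short (λ {p} {q} → ψ⇒φ {p} {q}))
  (reparametrise ψ φ parse-short sound-long (λ {p} {q} → φ⇒ψ {p} {q}))
  where open Slide d e αs

module Rotate (a e : ℕ) (αs : List ℕ) where

  core : Word → Word → Word → Word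
  core x y v = v ++ x ++ reverse x ++ y ++ reverse y

  record Parameters : Set where
    constructor parameters
    field
      x y v      : Word
      length-x   : length x ≡ a
      length-y   : length y ≡ e
      upper      : Upper αs v
      palindrome : Palindrome (core x y v)
  open Parameters

  long : Word → Word → Word → Word
  long x y v = (x ++ reverse x) ++ core x y v ++ reverse (x ++ reverse x)

  long-ends : ∀ x y v → ends x v (x ++ reverse x ++ y) ≡ long x y v
  long-ends x y v rewrite sym (++-assoc x (reverse x) y) | reverse-++ (x ++ reverse x) y | palindrome-double x =
    solve (++-monoid Letter)

  φ ψ : Parameters → Word
  φ p = long (x p) (y p) (v p)
  ψ p = core (x p) (y p) (v p)

  cong-long : ∀ {x x′ y y′ v v′} → x ≡ x′ → y ≡ y′ → v ≡ v′ → long x y v ≡ long x′ y′ v′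
  cong-long refl refl refl = refl

  ψ⇒φ : ∀ {p q} → ψ p ≡ ψ q → φ p ≡ φ q
  ψ⇒φ {p} {q} eq with ++-cancel-length (v p) (v q) (length-upper-cong αs (upper p) (upper q)) eq
  ... | v≡ , eq₁ with ++-cancel-length (x p) (x q) lx eq₁
    where
    lx : length (x p) ≡ length (x q)
    lx = trans (length-x p) (sym (length-x q))
  ... | x≡ , eq₂ with ++-cancel-length (reverse (x p)) (reverse (x q)) (cong (λ z → length (reverse z)) x≡) eq₂
  ... | _ , eq₃ with ++-cancel-length (y p) (y q) (trans (length-y p) (sym (length-y q))) eq₃
  ... | y≡ , _ = cong-long x≡ y≡ v≡

  φ⇒ψ : ∀ {p q} → φ p ≡ φ q → ψ p ≡ ψ q
  φ⇒ψ {p} {q} eq = ++-cancelʳ (reverse (prefix q)) _ _ (trans (cong (λ u → ψ p ++ reverse u) (sym (proj₁ cut))) (proj₂ cut))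
    where
    prefix : Parameters → Word
    prefix p = x p ++ reverse (x p)
    length-prefix : ∀ p → length (prefix p) ≡ 2 * a
    length-prefix p = trans (length-reverse-++ (x p)) (cong (2 *_) (length-x p))
    cut : prefix p ≡ prefix q × ψ p ++ reverse (prefix p) ≡ ψ q ++ reverse (prefix q)
    cut = ++-cancel-length (prefix p) (prefix q) (trans (length-prefix p) (sym (length-prefix q))) eq

  parse-long : ∀ {w} → Solution (a ∷ (αs ∷ʳ (a + (a + e)))) w → ∃ λ p → w ≡ φ p
  parse-long (up , pal) with upper-ends⁻ a αs (a + (a + e)) up
  ... | x , v , b , refl , lx , upv , lb with splitLength a b lb
  ... | x₁ , b′ , refl , lx₁ , lb′ with splitLength a b′ lb′
  ... | x₂ , y , refl , lx₂ , ly
    -- The last half-block, seen at the front of the palindrome, must start with the whole first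
    -- block: its first `a` letters are x, the next `a` are xʳ.
    with ++-cancel-length x₁ x (trans lx₁ (sym lx))
           (trans (sym (++-assoc x₁ (x₂ ++ y) _)) (trans (sym (reverse-ends x v (x₁ ++ x₂ ++ y))) pal))
  ... | refl , eq
    with ++-cancel-length x₂ (reverse x) (trans lx₂ (sym (trans (length-reverse x) lx)))
           (trans (sym (++-assoc x₂ y _)) eq)
  ... | refl , _ = parameters x y v lx ly upv
      (unframe (x ++ reverse x) (core x y v) (subst Palindrome (long-ends x y v) pal))
    , long-ends x y v

  parse-short : ∀ {w} → Solution (αs ++ a ∷ e ∷ []) w → ∃ λ p → w ≡ ψ p
  parse-short (up , pal) with upper-++⁻ αs up
  ... | v , _ , refl , upv , x , _ , refl , lx , y , _ , refl , ly , refl =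
    parameters x y v lx ly upv (subst Palindrome core≡ pal) , core≡
    where
    core≡ : v ++ x ++ reverse x ++ y ++ reverse y ++ [] ≡ core x y v
    core≡ = solve (++-monoid Letter)

  sound-long : ∀ p → Solution (a ∷ (αs ∷ʳ (a + (a + e)))) (φ p)
  sound-long (parameters x y v refl refl up pal) =
    subst₂ Upper (cong (λ b → length x ∷ (αs ∷ʳ b))
                   (trans (length-++ x) (cong (length x +_) (trans (length-++ (reverse x)) (cong (_+ length y) (length-reverse x))))))
      (long-ends x y v) (upper-ends⁺ αs {x} {v} {x ++ reverse x ++ y} up)
    , frame (x ++ reverse x) (core x y v) pal

  sound-short : ∀ p → Solution (αs ++ a ∷ e ∷ []) (ψ p)
  sound-short (parameters x y v refl refl up pal) =
    upper-++⁺ αs up (x , y ++ reverse y , refl , refl , upper-[ y ]) , pal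

𝒵-rotate : ∀ a e αs → 𝒵 (a ∷ (αs ∷ʳ (a + (a + e)))) ≡ 𝒵 (αs ++ a ∷ e ∷ [])
𝒵-rotate a e αs = 𝒵-cong
  (reparametrise φ ψ parse-long sound-short (λ {p} {q} → ψ⇒φ {p} {q}))
  (reparametrise ψ φ parse-short sound-long (λ {p} {q} → φ⇒ψ {p} {q}))
  where open Rotate a e αs

-- The recursion

𝒵-∷ʳ-zero : ∀ αs → 𝒵 (αs ∷ʳ 0) ≡ 𝒵 αs
𝒵-∷ʳ-zero αs = cong₂ (λ arcs n → length (deduplicate (connected? (arcs ++ rainbow 0 n)) (range (2 * n)))) (upper≡ 0 αs) sum≡
  where
  upper≡ : ∀ s αs → upperArcsFrom s (αs ∷ʳ 0) ≡ upperArcsFrom s αs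
  upper≡ s []       = refl
  upper≡ s (a ∷ αs) = cong (rainbow s a ++_) (upper≡ (s + 2 * a) αs)
  sum≡ : sum (αs ∷ʳ 0) ≡ sum αs
  sum≡ = trans (sum-++ αs _) (+-identityʳ (sum αs))

𝒵-singleton : ∀ a → 𝒵 (a ∷ []) ≡ a
𝒵-singleton a = ≤-antisym (OfLength-reflects-≤ (≼-trans (≼solution (a ∷ [])) halves)) (OfLength-reflects-≤ (≼-trans doubles (solution≼ (a ∷ []))))
  where
  halves : Solution (a ∷ []) ≼ OfLength a
  halves = record
    { to        = λ ((u , _ , _ , l , _) , _) → u , l
    ; injective = λ { ((u , _ , refl , l , refl) , _) ((_ , _ , refl , _ , refl) , _) refl → refl } }

  doubles : OfLength a ≼ Solution (a ∷ [])
  doubles = record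
    { to        = λ {u} l → u ++ reverse u , subst (λ n → Upper (n ∷ []) (u ++ reverse u)) l upper-[ u ] , palindrome-double u
    ; injective = λ {u} {v} l l′ eq → proj₁ (++-cancel-length u v (trans l (sym l′)) eq)
    }

-- A slide preserves the difference `d` of the two end entries and lowers both by `d`; `q` slides
-- carry out one division with remainder.
𝒵-slides : ∀ q d r αs → 𝒵 (r + q * d ∷ (αs ∷ʳ (r + q * d + d))) ≡ 𝒵 (r ∷ (αs ∷ʳ (r + d)))
𝒵-slides zero    d r αs = cong (λ x → 𝒵 (x ∷ (αs ∷ʳ (x + d)))) (+-identityʳ r)
𝒵-slides (suc q) d r αs = begin
  𝒵 (r + (d + q * d) ∷ (αs ∷ʳ (r + (d + q * d) + d)))     ≡⟨ cong₂ (λ a b → 𝒵 (a ∷ (αs ∷ʳ b))) (first r d (q * d)) (last r d (q * d)) ⟩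
  𝒵 (r + q * d + d ∷ (αs ∷ʳ (r + q * d + (d + d))))       ≡⟨ 𝒵-slide d (r + q * d) αs ⟩
  𝒵 (r + q * d ∷ (αs ∷ʳ (r + q * d + d)))                 ≡⟨ 𝒵-slides q d r αs ⟩
  𝒵 (r ∷ (αs ∷ʳ (r + d)))                                 ∎
  where
  open ≡-Reasoning
  first : ∀ r d x → r + (d + x) ≡ r + x + d
  first = solve-∀
  last : ∀ r d x → r + (d + x) + d ≡ r + x + (d + d)
  last = solve-∀

-- The induction needs two lists: `as` holds the entries yet to be moved, `bs` the entries that
-- follow them. Each rotation moves the head of `as` behind `bs` and takes twice its value from the
-- last entry.
𝒵-rotations : ∀ as bs e → 𝒵 ((as ++ bs) ∷ʳ (2 * sum as + e)) ≡ 𝒵 ((bs ++ as) ∷ʳ e)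
𝒵-rotations []       bs e = cong (λ cs → 𝒵 (cs ∷ʳ e)) (sym (++-identityʳ bs))
𝒵-rotations (a ∷ as) bs e = begin
  𝒵 (a ∷ ((as ++ bs) ∷ʳ (2 * (a + sum as) + e)))     ≡⟨ cong (λ b → 𝒵 (a ∷ ((as ++ bs) ∷ʳ b))) (split a (sum as) e) ⟩
  𝒵 (a ∷ ((as ++ bs) ∷ʳ (a + (a + b))))              ≡⟨ 𝒵-rotate a b (as ++ bs) ⟩
  𝒵 ((as ++ bs) ++ a ∷ b ∷ [])                       ≡⟨ cong 𝒵 (regroup as bs (b ∷ [])) ⟩
  𝒵 ((as ++ bs ∷ʳ a) ∷ʳ b)                           ≡⟨ 𝒵-rotations as (bs ∷ʳ a) e ⟩
  𝒵 ((bs ∷ʳ a ++ as) ∷ʳ e)                           ≡⟨ cong (λ cs → 𝒵 (cs ∷ʳ e)) (++-assoc bs (a ∷ []) as) ⟩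
  𝒵 ((bs ++ a ∷ as) ∷ʳ e)                            ∎
  where
  open ≡-Reasoning
  b = 2 * sum as + e
  split : ∀ a s e → 2 * (a + s) + e ≡ a + (a + (2 * s + e))
  split = solve-∀
  regroup : ∀ as bs cs → (as ++ bs) ++ a ∷ cs ≡ (as ++ bs ∷ʳ a) ++ cs
  regroup as bs cs = trans (sym (++-assoc (as ++ bs) (a ∷ []) cs)) (cong (_++ cs) (++-assoc as bs (a ∷ [])))

-- Rotating once through all of `as` restores its order, so only the last entry has changed.
𝒵-revolutions : ∀ q as r → 𝒵 (as ∷ʳ (r + q * (2 * sum as))) ≡ 𝒵 (as ∷ʳ r)
𝒵-revolutions zero    as r = cong (λ x → 𝒵 (as ∷ʳ x)) (+-identityʳ r)
𝒵-revolutions (suc q) as r = begin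
  𝒵 (as ∷ʳ (r + (2 * sum as + q * (2 * sum as))))          ≡⟨ cong₂ (λ cs b → 𝒵 (cs ∷ʳ b)) (sym (++-identityʳ as)) (swap r (2 * sum as) (q * (2 * sum as))) ⟩
  𝒵 ((as ++ []) ∷ʳ (2 * sum as + (r + q * (2 * sum as))))  ≡⟨ 𝒵-rotations as [] _ ⟩
  𝒵 (as ∷ʳ (r + q * (2 * sum as)))                         ≡⟨ 𝒵-revolutions q as r ⟩
  𝒵 (as ∷ʳ r)                                              ∎
  where
  open ≡-Reasoning
  swap : ∀ r d x → r + (d + x) ≡ d + (r + x)
  swap = solve-∀

ℛ-quotient : ∀ a {c} → 0 < c → ∃[ q ] a ≡ ℛ a c + q * c
ℛ-quotient a {suc c} _ = a / suc c , m≡m%n+[m/n]*n a (suc c)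

ℛ-< : ∀ a {c} → 0 < c → ℛ a c < c
ℛ-< a {suc c} _ = m%n<n a (suc c)

-- The quotient is at least 1. Since the remainder is below `c`, twice the remainder is then less
-- than `a`, which is what makes bit lengths drop.
ℛ+divisor≤ : ∀ {a c} → 0 < c → c ≤ a → ℛ a c + c ≤ a
ℛ+divisor≤ {a} {c} 0<c c≤a with ℛ-quotient a 0<c
... | zero  , a≡ = contradiction (subst (_< c) (sym (trans a≡ (+-identityʳ _))) (ℛ-< a 0<c)) (≤⇒≯ c≤a)
... | suc q , a≡ = subst (ℛ a c + c ≤_) (sym a≡) (+-monoʳ-≤ (ℛ a c) (m≤m+n c (q * c)))

∣⇒ℛ≡0 : ∀ {a c} → 0 < c → c ∣ a → ℛ a c ≡ 0
∣⇒ℛ≡0 {a} {suc c} _ c∣a = n∣m⇒m%n≡0 a (suc c) c∣a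

module Cases (a : ℕ) (as : List ℕ) (b : ℕ) where

  tuple : List ℕ
  tuple = a ∷ (as ∷ʳ b)

  reverse-tuple : reverse tuple ≡ b ∷ (reverse as ∷ʳ a)
  reverse-tuple = trans (unfold-reverse a (as ∷ʳ b)) (cong (_∷ʳ a) (reverse-++ as (b ∷ [])))

  sum-tuple : sum tuple ≡ sum (a ∷ as) + b
  sum-tuple = trans (sum-++ (a ∷ as) (b ∷ [])) (cong (sum (a ∷ as) +_) (+-identityʳ b))

  sum-init : sum tuple ∸ b ≡ sum (a ∷ as)
  sum-init = trans (cong (_∸ b) sum-tuple) (m+n∸n≡m (sum (a ∷ as)) b)

  0<2sum-init : 0 < a → 0 < 2 * sum (a ∷ as)
  0<2sum-init 0<a = ≤-trans 0<a (≤-trans (m≤m+n a (sum as)) (m≤m+n _ _))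

  reversed : 𝒵 tuple ≡ 𝒵 (b ∷ (reverse as ∷ʳ a))
  reversed = trans (𝒵-reverse tuple) (cong 𝒵 reverse-tuple)

  equal : a ≡ b → 𝒵 tuple ≡ 𝒵 as + a
  equal refl = 𝒵-equalEnds a as

  remainder : a < b → 𝒵 tuple ≡ 𝒵 (ℛ a (b ∸ a) ∷ (as ∷ʳ (b ∸ a + ℛ a (b ∸ a))))
  remainder a<b = begin
    𝒵 (a ∷ (as ∷ʳ b))                           ≡⟨ cong₂ (λ x y → 𝒵 (x ∷ (as ∷ʳ y))) a≡ b≡ ⟩
    𝒵 (r + q * d ∷ (as ∷ʳ (r + q * d + d)))     ≡⟨ 𝒵-slides q d r as ⟩
    𝒵 (r ∷ (as ∷ʳ (r + d)))                     ≡⟨ cong (λ x → 𝒵 (r ∷ (as ∷ʳ x))) (+-comm r d) ⟩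
    𝒵 (r ∷ (as ∷ʳ (d + r)))                     ∎
    where
    open ≡-Reasoning
    d = b ∸ a
    r = ℛ a d
    q = proj₁ (ℛ-quotient a (m<n⇒0<n∸m a<b))
    a≡ : a ≡ r + q * d
    a≡ = proj₂ (ℛ-quotient a (m<n⇒0<n∸m a<b))
    b≡ : b ≡ r + q * d + d
    b≡ = trans (sym (m+[n∸m]≡n (<⇒≤ a<b))) (cong (_+ d) a≡)

  rotated : 2 * a ≤ b → 𝒵 tuple ≡ 𝒵 (as ++ a ∷ (b ∸ 2 * a) ∷ [])
  rotated 2a≤b = trans (cong (λ x → 𝒵 (a ∷ (as ∷ʳ x))) b≡) (𝒵-rotate a (b ∸ 2 * a) as)
    where
    b≡ : b ≡ a + (a + (b ∸ 2 * a))
    b≡ = trans (sym (m+[n∸m]≡n 2a≤b)) (split a (b ∸ 2 * a))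
      where
      split : ∀ a x → 2 * a + x ≡ a + (a + x)
      split = solve-∀

  -- A rotation that leaves an empty last family.
  doubled : 2 * a ≡ b → 𝒵 tuple ≡ 𝒵 (as ∷ʳ a)
  doubled refl = begin
    𝒵 tuple                            ≡⟨ rotated ≤-refl ⟩
    𝒵 (as ++ a ∷ (2 * a ∸ 2 * a) ∷ []) ≡⟨ cong (λ x → 𝒵 (as ++ a ∷ x ∷ [])) (n∸n≡0 (2 * a)) ⟩
    𝒵 (as ++ a ∷ 0 ∷ [])               ≡⟨ cong 𝒵 (++-assoc as (a ∷ []) (0 ∷ [])) ⟨
    𝒵 ((as ∷ʳ a) ∷ʳ 0)                 ≡⟨ 𝒵-∷ʳ-zero (as ∷ʳ a) ⟩
    𝒵 (as ∷ʳ a)                        ∎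
    where
    open ≡-Reasoning

  lastRemainder : 0 < a → 𝒵 tuple ≡ 𝒵 (a ∷ (as ∷ʳ ℛ b (2 * sum (a ∷ as))))
  lastRemainder 0<a with ℛ-quotient b {2 * sum (a ∷ as)} (0<2sum-init 0<a)
  ... | q , b≡ = trans (cong (λ x → 𝒵 (a ∷ (as ∷ʳ x))) b≡) (𝒵-revolutions q (a ∷ as) (ℛ b (2 * sum (a ∷ as))))

  lastRemoved : 0 < a → ℛ b (2 * sum (a ∷ as)) ≡ 0 → 𝒵 tuple ≡ 𝒵 (a ∷ as)
  lastRemoved 0<a r≡0 = trans (lastRemainder 0<a) (trans (cong (λ x → 𝒵 (a ∷ (as ∷ʳ x))) r≡0) (𝒵-∷ʳ-zero (a ∷ as)))

-- With the predicate left arbitrary, a chain of tests inside a goal can be followed branch by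
-- branch, each branch receiving evidence for the outcome of its test.
if-dec : ∀ {A Q : Set} {x y : A} (P : A → Set) (d : Dec Q) → (Q → P x) → (¬ Q → P y) → P (if does d then x else y)
if-dec P (yes q) px py = px q
if-dec P (no ¬q) px py = py ¬q

-- A leading empty family disappears by computation, as it contributes no arcs and no offset. What
-- remains is that the filter keeps positive entries.
𝒵-removeZeros-∷ : ∀ r {αs} → All (0 <_) αs → 𝒵 (removeZeros (r ∷ αs)) ≡ 𝒵 (r ∷ αs)
𝒵-removeZeros-∷ zero    pos = cong 𝒵 (filter-all (0 <?_) pos)
𝒵-removeZeros-∷ (suc r) pos = cong 𝒵 (filter-all (0 <?_) (z<s {r} ∷ pos))

-- The number of rounds

bitLength : ℕ → ℕ
bitLength a = ⌈log₂ (a + 1) ⌉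

bitLength-mono : ∀ {a b} → a ≤ b → bitLength a ≤ bitLength b
bitLength-mono a≤b = ⌈log₂⌉-mono-≤ (+-monoˡ-≤ 1 a≤b)

-- Here 2 (r + 1) ≤ a + 1, and doubling the argument adds 1 to the logarithm.
bitLength-double : ∀ {r a} → r + r < a → bitLength r < bitLength a
bitLength-double {r} {a} 2r<a = begin
  suc ⌈log₂ (r + 1) ⌉       ≡⟨ cong (λ n → suc ⌈log₂ n ⌉) (+-comm r 1) ⟩
  suc ⌈log₂ (suc r) ⌉       ≡⟨ ⌈log₂2*n⌉≡1+⌈log₂n⌉ (suc r) ⟨
  ⌈log₂ (2 * suc r) ⌉       ≤⟨ ⌈log₂⌉-mono-≤ 2r+2≤a+1 ⟩
  ⌈log₂ (a + 1) ⌉           ∎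
  where
  open ≤-Reasoning
  2r+2≤a+1 : 2 * suc r ≤ a + 1
  2r+2≤a+1 = subst (_≤ a + 1) (double r) (+-monoˡ-≤ 1 2r<a)
    where
    double : ∀ r → suc (r + r) + 1 ≡ 2 * suc r
    double = solve-∀

bitLength-positive : ∀ {a} → 0 < a → 0 < bitLength a
bitLength-positive 0<a = ≤-<-trans z≤n (bitLength-double {0} 0<a)

sum-∷ʳ : ∀ as b → sum (as ∷ʳ b) ≡ b + sum as
sum-∷ʳ as b = trans (sum-++ as (b ∷ [])) (trans (cong (sum as +_) (+-identityʳ b)) (+-comm (sum as) b))

bits-∷ʳ : ∀ as b → bits (as ∷ʳ b) ≡ bitLength b + bits as
bits-∷ʳ as b = trans (cong sum (map-++ bitLength as (b ∷ []))) (sum-∷ʳ (map bitLength as) (bitLength b))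

length-∷ʳ : ∀ (as : List ℕ) b → length (as ∷ʳ b) ≡ suc (length as)
length-∷ʳ as b = trans (length-++ as) (+-comm (length as) 1)

-- This is Φ without subtraction. The last entry counts once and the others twice, so moving the
-- larger end entry to the last place never increases it.
weight : List ℕ → ℕ → ℕ
weight as b = 2 * bits as + bitLength b

weight≤2bits : ∀ as b → weight as b ≤ 2 * bits (as ∷ʳ b)
weight≤2bits as b = begin
  2 * bits as + bitLength b        ≤⟨ +-monoʳ-≤ (2 * bits as) (m≤m+n _ _) ⟩
  2 * bits as + 2 * bitLength b    ≡⟨ +-comm (2 * bits as) _ ⟩
  2 * bitLength b + 2 * bits as    ≡⟨ *-distribˡ-+ 2 (bitLength b) (bits as) ⟨
  2 * (bitLength b + bits as)      ≡⟨ cong (2 *_) (bits-∷ʳ as b) ⟨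
  2 * bits (as ∷ʳ b)               ∎
  where open ≤-Reasoning

-- Bounds the number of successive rounds that leave the weight of as ∷ʳ l unchanged.
steps : ℕ → List ℕ → ℕ
steps l []       = 0
steps l (a ∷ as) =
  if does (l <? a) then 1
  else if does (a + a <? l) then suc (steps (l ∸ (a + a)) as)
  else 0

steps≤length : ∀ l as → steps l as ≤ length as
steps≤length l []       = z≤n
steps≤length l (a ∷ as) = if-dec (_≤ suc (length as)) (l <? a) (λ _ → s≤s z≤n) λ _ →
  if-dec (_≤ suc (length as)) (a + a <? l) (λ _ → s≤s (steps≤length (l ∸ (a + a)) as)) (λ _ → z≤n)

steps-swap : ∀ {l a} as → l < a → steps l (a ∷ as) ≡ 1
steps-swap {l} {a} as l<a = if-dec (_≡ 1) (l <? a) (λ _ → refl) (λ l≮a → contradiction l<a l≮a)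

steps-stop : ∀ {l a} as → a ≤ l → l ≤ a + a → steps l (a ∷ as) ≡ 0
steps-stop {l} {a} as a≤l l≤2a = if-dec (_≡ 0) (l <? a) (λ l<a → contradiction a≤l (<⇒≱ l<a)) λ _ →
  if-dec (_≡ 0) (a + a <? l) (λ 2a<l → contradiction l≤2a (<⇒≱ 2a<l)) (λ _ → refl)

steps-rotate : ∀ {l a} as → a + a < l → steps l (a ∷ as) ≡ suc (steps (l ∸ (a + a)) as)
steps-rotate {l} {a} as 2a<l = if-dec (_≡ suc (steps (l ∸ (a + a)) as)) (l <? a)
  (λ l<a → contradiction (<-trans (≤-<-trans (m≤m+n a a) 2a<l) l<a) (<-irrefl refl)) λ _ →
  if-dec (_≡ suc (steps (l ∸ (a + a)) as)) (a + a <? l) (λ _ → refl) (λ 2a≮l → contradiction 2a<l 2a≮l)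

-- A run of rotations ends before it comes back to its first entry.
steps-∷ʳ : ∀ {l} as a → 0 < l → l ≤ sum as + sum as → steps l (as ∷ʳ a) ≡ steps l as
steps-∷ʳ {l} []       a 0<l l≤0 = contradiction 0<l (≤⇒≯ l≤0)
steps-∷ʳ {l} (x ∷ as) a 0<l l≤2S with l <? x
... | yes l<x = trans (steps-swap (as ∷ʳ a) l<x) (sym (steps-swap as l<x))
... | no  l≮x with x + x <? l
...   | no  2x≮l = trans (steps-stop (as ∷ʳ a) (≮⇒≥ l≮x) (≮⇒≥ 2x≮l)) (sym (steps-stop as (≮⇒≥ l≮x) (≮⇒≥ 2x≮l)))
...   | yes 2x<l = trans (steps-rotate {l} {x} (as ∷ʳ a) 2x<l)
        (trans (cong suc (steps-∷ʳ as a (m<n⇒0<n∸m 2x<l) rest)) (sym (steps-rotate {l} {x} as 2x<l)))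
  where
  rest : l ∸ (x + x) ≤ sum as + sum as
  rest = m≤n+o⇒m∸n≤o l (x + x) (subst (l ≤_) (regroup x (sum as)) l≤2S)
    where
    regroup : ∀ x s → (x + s) + (x + s) ≡ (x + x) + (s + s)
    regroup = solve-∀

-- Lexicographic descent: either the weight drops, or it does not grow and the current run of
-- weight-preserving rounds gets shorter.
Decrease : List ℕ → ℕ → List ℕ → ℕ → Set
Decrease as b as′ b′ =
  weight as′ b′ < weight as b ⊎ (weight as′ b′ ≤ weight as b × steps b′ as′ < steps b as)

-- Quantifying over the decompositions of `βs` makes the condition vacuous for the empty tuple,
-- which has no last entry.
record Progress (as : List ℕ) (b : ℕ) (βs : List ℕ) : Set where
  constructor progressing
  field
    decrease : ∀ {as′ b′} → βs ≡ as′ ∷ʳ b′ → Decrease as b as′ b′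

-- For rounds after which the new last entry is some unnamed inner entry: twice all bits bounds the
-- weight whichever entry comes last.
progress-bits : ∀ {as b βs} → 2 * bits βs < weight as b → Progress as b βs
progress-bits lt = progressing λ { {as′} {b′} refl → inj₁ (≤-<-trans (weight≤2bits as′ b′) lt) }

progress-∷ʳ : ∀ {as b} as′ b′ → Decrease as b as′ b′ → Progress as b (as′ ∷ʳ b′)
progress-∷ʳ {as} {b} as′ b′ p = progressing λ {as″} eq →
  let as≡ , b≡ = ∷ʳ-injective as′ as″ eq in subst₂ (Decrease as b) as≡ b≡ p

-- Correctness, progress and cost of a single round

record Sound (a : ℕ) (as : List ℕ) (b : ℕ) (α′ : ℕ) (βs : List ℕ) (k : ℕ) : Set where
  field
    sum≡     : α′ ≡ sum βs
    positive : All (0 <_) βs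
    𝒵≡       : 𝒵 βs + k ≡ 𝒵 (a ∷ (as ∷ʳ b))
    shorter  : length βs ≤ length (a ∷ (as ∷ʳ b))
    progress : Progress (a ∷ as) b βs
open Sound

double : ∀ n → n + n ≡ 2 * n
double n = cong (n +_) (sym (+-identityʳ n))

module Rounds (α a : ℕ) (as : List ℕ) (b : ℕ) (α≡ : α ≡ sum (a ∷ (as ∷ʳ b)))
              (0<a : 0 < a) (pos : All (0 <_) as) (0<b : 0 < b) where
  open Cases a as b

  α≡′ : α ≡ a + (b + sum as)
  α≡′ = trans α≡ (cong (a +_) (sum-∷ʳ as b))

  difference : ∀ x {y} → α ≡ x + y → α ∸ x ≡ y
  difference x {y} eq = trans (cong (_∸ x) eq) (m+n∸m≡n x y)

  2bits<weight : 2 * bits (a ∷ as) < weight (a ∷ as) b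
  2bits<weight = m<m+n (2 * bits (a ∷ as)) (bitLength-positive 0<b)

  weight-< : ∀ {p q} → p < bitLength a → q ≤ bitLength b → 2 * (p + bits as) + q < weight (a ∷ as) b
  weight-< p< q≤ = +-mono-<-≤ (*-monoʳ-< 2 (+-monoˡ-< (bits as) p<)) q≤

  length-tail : length as ≤ length tuple
  length-tail = ≤-trans (length-++-≤ˡ as) (n≤1+n _)

  length-last : ∀ x → length (as ∷ʳ x) ≡ length (as ∷ʳ b)
  length-last x = trans (length-∷ʳ as x) (sym (length-∷ʳ as b))

  swap : b < a → Sound a as b α (b ∷ (reverse as ∷ʳ a)) 0
  swap b<a = record
    { sum≡     = trans α≡ (trans (sym (sum-↭ (↭-reverse tuple))) (cong sum reverse-tuple))
    ; positive = 0<b ∷ Allₚ.∷ʳ⁺ (All-resp-↭ (↭-sym (↭-reverse as)) pos) 0<a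
    ; 𝒵≡       = trans (+-identityʳ _) (sym reversed)
    ; shorter  = ≤-reflexive (trans (cong length (sym reverse-tuple)) (length-reverse tuple))
    ; progress = progress-∷ʳ (b ∷ reverse as) a decrease
    }
    where
    bits-reverse : bits (reverse as) ≡ bits as
    bits-reverse = sum-↭ (map⁺ bitLength (↭-reverse as))

    weight≡ : weight (b ∷ reverse as) a ≡ 2 * bits as + (bitLength b + bitLength a) + bitLength b
    weight≡ = trans (cong (λ B → 2 * (bitLength b + B) + bitLength a) bits-reverse)
                    (regroup (bitLength b) (bits as) (bitLength a))
      where
      regroup : ∀ x B y → 2 * (x + B) + y ≡ 2 * B + (x + y) + x
      regroup = solve-∀

    weight≡′ : weight (a ∷ as) b ≡ 2 * bits as + (bitLength b + bitLength a) + bitLength a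
    weight≡′ = regroup (bitLength a) (bits as) (bitLength b)
      where
      regroup : ∀ y B x → 2 * (y + B) + x ≡ 2 * B + (x + y) + y
      regroup = solve-∀

    decrease : Decrease (a ∷ as) b (b ∷ reverse as) a
    -- If 2b < a, the two bit lengths differ and the weight drops. Otherwise b ≤ a ≤ 2b, so after
    -- the swap neither a swap nor a rotation follows, and `steps` falls from 1 to 0.
    decrease with b + b <? a
    ... | yes 2b<a = inj₁ (subst₂ _<_ (sym weight≡) (sym weight≡′) (+-monoʳ-< (2 * bits as + (bitLength b + bitLength a)) (bitLength-double {b} {a} 2b<a)))
    ... | no  2b≮a = inj₂
      ( subst₂ _≤_ (sym weight≡) (sym weight≡′) (+-monoʳ-≤ (2 * bits as + (bitLength b + bitLength a)) (bitLength-mono (<⇒≤ b<a)))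
      , subst₂ _<_ (sym (steps-stop (reverse as) (<⇒≤ b<a) (≮⇒≥ 2b≮a))) (sym (steps-swap as b<a)) z<s )

  equalEnds : a ≡ b → Sound a as b (α ∸ (a + a)) as a
  equalEnds refl = record
    { sum≡     = difference (a + a) (trans α≡′ (sym (+-assoc a a (sum as))))
    ; positive = pos
    ; 𝒵≡       = sym (equal refl)
    ; shorter  = length-tail
    ; progress = progress-bits (≤-<-trans (*-monoʳ-≤ 2 (m≤n+m (bits as) (bitLength a))) 2bits<weight)
    }

  module _ (a<b : a < b) (b<2a : b < a + a) where
    d r : ℕ
    d = b ∸ a
    r = ℛ a d

    private
      0<d : 0 < d
      0<d = m<n⇒0<n∸m a<b

      b≡ : b ≡ a + d
      b≡ = sym (m+[n∸m]≡n (<⇒≤ a<b))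

      d≤a : d ≤ a
      d≤a = +-cancelˡ-≤ a d a (subst (_≤ a + a) b≡ (<⇒≤ b<2a))

      r+d≤a : r + d ≤ a
      r+d≤a = ℛ+divisor≤ 0<d d≤a

      r+r<a : r + r < a
      r+r<a = <-≤-trans (+-monoʳ-< r (ℛ-< a 0<d)) r+d≤a

      last≤ : bitLength (d + r) ≤ bitLength b
      last≤ = bitLength-mono (≤-trans (≤-reflexive (+-comm d r)) (≤-trans r+d≤a (<⇒≤ a<b)))

      0<d+r : 0 < d + r
      0<d+r = ≤-trans 0<d (m≤m+n d r)

      new-sum : α ∸ (a + b) + (r + (d + r)) ≡ r + sum (as ∷ʳ (d + r))
      new-sum = begin
        α ∸ (a + b) + (r + (d + r))  ≡⟨ cong (_+ (r + (d + r))) (difference (a + b) (trans α≡′ (sym (+-assoc a b (sum as))))) ⟩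
        sum as + (r + (d + r))       ≡⟨ regroup (sum as) r (d + r) ⟩
        r + (d + r + sum as)         ≡⟨ cong (r +_) (sum-∷ʳ as (d + r)) ⟨
        r + sum (as ∷ʳ (d + r))      ∎
        where
        open ≡-Reasoning
        regroup : ∀ s r x → s + (r + x) ≡ r + (x + s)
        regroup = solve-∀

    remainderRound : Sound a as b (α ∸ (a + b) + (r + (d + r)))
                      (if does (r ≟ 0) then as ∷ʳ (d + r) else r ∷ (as ∷ʳ (d + r))) 0
    remainderRound = if-dec (λ βs → Sound a as b (α ∸ (a + b) + (r + (d + r))) βs 0) (r ≟ 0)
      (λ r≡0 → record
        { sum≡     = trans new-sum (cong (_+ sum (as ∷ʳ (d + r))) r≡0)
        ; positive = Allₚ.∷ʳ⁺ pos 0<d+r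
        ; 𝒵≡       = trans (+-identityʳ _) (sym (trans (remainder a<b) (cong (λ x → 𝒵 (x ∷ (as ∷ʳ (d + r)))) r≡0)))
        ; shorter  = ≤-trans (≤-reflexive (length-last (d + r))) (n≤1+n _)
        ; progress = progress-∷ʳ as (d + r) (inj₁ (weight-< (bitLength-positive 0<a) last≤))
        })
      (λ r≢0 → record
        { sum≡     = new-sum
        ; positive = n≢0⇒n>0 r≢0 ∷ Allₚ.∷ʳ⁺ pos 0<d+r
        ; 𝒵≡       = trans (+-identityʳ _) (sym (remainder a<b))
        ; shorter  = s≤s (≤-reflexive (length-last (d + r)))
        ; progress = progress-∷ʳ (r ∷ as) (d + r) (inj₁ (weight-< (bitLength-double {r} {a} r+r<a) last≤))
        })

  doubleRound : a + a ≡ b → Sound a as b (α ∸ (a + a)) (as ∷ʳ a) 0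
  doubleRound 2a≡b = record
    { sum≡     = trans (difference (a + a) (trans α≡′ (trans (cong (λ x → a + (x + sum as)) (sym 2a≡b)) (regroup a (sum as)))))
                       (sym (sum-∷ʳ as a))
    ; positive = Allₚ.∷ʳ⁺ pos 0<a
    ; 𝒵≡       = trans (+-identityʳ _) (sym (doubled (trans (sym (double a)) 2a≡b)))
    ; shorter  = ≤-trans (≤-reflexive (length-last a)) (n≤1+n _)
    ; progress = progress-∷ʳ as a (inj₁ (weight-< (bitLength-positive 0<a) (bitLength-mono (≤-trans (m≤m+n a a) (≤-reflexive 2a≡b)))))
    }
    where
    regroup : ∀ a s → a + (a + a + s) ≡ a + a + (a + s)
    regroup = solve-∀

  rotateRound : a + a < b → b + b + b < α + α → Sound a as b (α ∸ (a + a)) (as ++ a ∷ b ∸ (a + a) ∷ []) 0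
  rotateRound 2a<b 3b<2α = subst (λ βs → Sound a as b (α ∸ (a + a)) βs 0) (++-assoc as (a ∷ []) (e ∷ [])) record
    { sum≡     = trans (difference (a + a) (trans α≡′ (trans (cong (λ x → a + (x + sum as)) b≡) (regroup a e (sum as)))))
                       (sym (trans (sum-∷ʳ (as ∷ʳ a) e) (cong (e +_) (sum-∷ʳ as a))))
    ; positive = Allₚ.∷ʳ⁺ (Allₚ.∷ʳ⁺ pos 0<a) (m<n⇒0<n∸m 2a<b)
    ; 𝒵≡       = trans (+-identityʳ _) (trans (cong 𝒵 (++-assoc as (a ∷ []) (e ∷ [])))
                   (sym (subst (λ x → 𝒵 tuple ≡ 𝒵 (as ++ a ∷ b ∸ x ∷ [])) (sym (double a))
                     (rotated (≤-trans (≤-reflexive (sym (double a))) (<⇒≤ 2a<b))))))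
    ; shorter  = ≤-reflexive (trans (length-∷ʳ (as ∷ʳ a) e) (cong suc (length-last a)))
    ; progress = progress-∷ʳ (as ∷ʳ a) e (inj₂
        ( +-mono-≤ (*-monoʳ-≤ 2 (≤-reflexive (bits-∷ʳ as a))) (bitLength-mono (m∸n≤m b (a + a)))
        , ≤-reflexive (trans (cong suc (steps-∷ʳ as a (m<n⇒0<n∸m 2a<b) e≤2S)) (sym (steps-rotate {b} {a} as 2a<b))) ))
    }
    where
    e : ℕ
    e = b ∸ (a + a)
    b≡ : b ≡ a + a + e
    b≡ = sym (m+[n∸m]≡n (<⇒≤ 2a<b))
    regroup : ∀ a e s → a + (a + a + e + s) ≡ a + a + (e + (a + s))
    regroup = solve-∀

    -- The test 3b < 2α amounts to b < 2a + 2S, where S is the sum of `as`. Hence `e` is used up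
    -- before the run of rotations reaches `a` again.
    e≤2S : e ≤ sum as + sum as
    e≤2S = m≤n+o⇒m∸n≤o b (a + a) (<⇒≤ (+-cancelˡ-< (b + b) _ _ (subst (b + b + b <_) (trans (cong (λ x → x + x) α≡′) (regroup′ a b (sum as))) 3b<2α)))
      where
      regroup′ : ∀ a b s → a + (b + s) + (a + (b + s)) ≡ b + b + (a + a + (s + s))
      regroup′ = solve-∀

  module _ (2α≤3b : α + α ≤ b + b + b) where
    A c r′ : ℕ
    A = α ∸ b
    c = A + A
    r′ = ℛ b c

    private
      A≡ : A ≡ sum (a ∷ as)
      A≡ = difference b (trans α≡′ (regroup a b (sum as)))
        where
        regroup : ∀ a b s → a + (b + s) ≡ b + (a + s)
        regroup = solve-∀

      c≡ : c ≡ 2 * sum (a ∷ as)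
      c≡ = trans (double A) (cong (2 *_) A≡)

      0<c : 0 < c
      0<c = ≤-trans (≤-trans (≤-trans 0<a (m≤m+n a (sum as))) (≤-reflexive (sym A≡))) (m≤m+n A A)

      -- Failure of that test, 2α ≤ 3b, amounts to 2(α - b) ≤ b, so the division has a nonzero
      -- quotient.
      c≤b : c ≤ b
      c≤b = +-cancelˡ-≤ (b + b) c b (subst (_≤ b + b + b) (trans (cong (λ x → x + x) α≡″) (regroup b A)) 2α≤3b)
        where
        α≡″ : α ≡ b + A
        α≡″ = sym (m+[n∸m]≡n (subst (b ≤_) (sym α≡′) (≤-trans (m≤m+n b (sum as)) (m≤n+m _ a))))
        regroup : ∀ b A → b + A + (b + A) ≡ b + b + (A + A)
        regroup = solve-∀

      r≡ : r′ ≡ ℛ b (2 * sum (a ∷ as))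
      r≡ = cong (ℛ b) c≡

      r+r<b : r′ + r′ < b
      r+r<b = <-≤-trans (+-monoʳ-< r′ (ℛ-< b 0<c)) (ℛ+divisor≤ 0<c c≤b)

    lastRound : Sound a as b (A + r′) (if does (r′ ≟ 0) then a ∷ as else a ∷ (as ∷ʳ r′)) 0
    lastRound = if-dec (λ βs → Sound a as b (A + r′) βs 0) (r′ ≟ 0)
      (λ r≡0 → record
        { sum≡     = trans (cong (A +_) r≡0) (trans (+-identityʳ A) A≡)
        ; positive = 0<a ∷ pos
        ; 𝒵≡       = trans (+-identityʳ _) (sym (lastRemoved 0<a (trans (sym r≡) r≡0)))
        ; shorter  = s≤s (length-++-≤ˡ as)
        ; progress = progress-bits 2bits<weight
        })
      (λ r≢0 → record
        { sum≡     = trans (cong (_+ r′) A≡) (trans (regroup a (sum as) r′) (cong (a +_) (sym (sum-∷ʳ as r′))))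
        ; positive = 0<a ∷ Allₚ.∷ʳ⁺ pos (n≢0⇒n>0 r≢0)
        ; 𝒵≡       = trans (+-identityʳ _) (sym (trans (lastRemainder 0<a) (cong (λ x → 𝒵 (a ∷ (as ∷ʳ x))) (sym r≡))))
        ; shorter  = s≤s (≤-reflexive (length-last r′))
        ; progress = progress-∷ʳ (a ∷ as) r′ (inj₁ (+-monoʳ-< (2 * bits (a ∷ as)) (bitLength-double {r′} {b} r+r<b)))
        })
      where
      regroup : ∀ a s r → a + s + r ≡ a + (r + s)
      regroup = solve-∀

  -- `n` is the number of operations already spent on the way to the current branch. The bound 15 is
  -- attained in the last branch: ten operations up to its test and five more.
  SoundWithin : ℕ → Counted (ℕ × List ℕ × ℕ) → Set
  SoundWithin n c = let (α′ , βs , k) = value c in Sound a as b α′ βs k × n + ops c ≤ 15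

  sound-round : SoundWithin 0 (round α a as b)
  sound-round =
    if-dec (SoundWithin 1) (b <? a) (λ b<a → swap b<a , ≤ᵇ⇒≤ _ _ tt) λ b≮a →
    if-dec (SoundWithin 4) (a ≟ b) (λ a≡b → equalEnds a≡b , ≤ᵇ⇒≤ _ _ tt) λ a≢b →
    if-dec (SoundWithin 5) (b <? a + a) (λ b<2a → remainderRound (≤∧≢⇒< (≮⇒≥ b≮a) a≢b) b<2a , ≤ᵇ⇒≤ _ _ tt) λ b≮2a →
    if-dec (SoundWithin 6) (a + a ≟ b) (λ 2a≡b → doubleRound 2a≡b , ≤ᵇ⇒≤ _ _ tt) λ 2a≢b →
    if-dec (SoundWithin 10) (b + b + b <? α + α)
      (λ 3b<2α → rotateRound (≤∧≢⇒< (≮⇒≥ b≮2a) 2a≢b) 3b<2α , ≤ᵇ⇒≤ _ _ tt)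
      (λ 3b≮2α → lastRound (≮⇒≥ 3b≮2α) , ≤ᵇ⇒≤ _ _ tt)

-- Iterating the rounds

Computes : ℕ → List ℕ → ℕ → Set
Computes α αs n = ∃[ c ] Iterates α αs c × value c ≡ 𝒵 αs × ops c ≤ n

-- The lexicographic pair is flattened to one number: `n` is a fixed bound for the length of the
-- tuple, hence exceeds every value of `steps`.
Bounded : ℕ → ℕ → List ℕ → Set
Bounded n fuel αs = ∀ {as b} → αs ≡ as ∷ʳ b → weight as b * n + steps b as < fuel

progress-bounded : ∀ {n fuel as b βs} → length βs ≤ n → Progress as b βs →
                   weight as b * n + steps b as ≤ fuel → Bounded n fuel βs
progress-bounded {n} {fuel} {as} {b} len prog bound {as′} {b′} refl with Progress.decrease prog refl
... | inj₂ (w≤ , s<) = <-≤-trans (+-mono-≤-< (*-monoˡ-≤ n w≤) s<) bound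
-- One unit of weight is worth `n`, which pays for any new value of `steps`.
... | inj₁ w< = begin-strict
  weight as′ b′ * n + steps b′ as′    <⟨ +-monoʳ-< (weight as′ b′ * n) (<-≤-trans (s≤s (steps≤length b′ as′)) (≤-trans (≤-reflexive (sym (length-∷ʳ as′ b′))) len)) ⟩
  weight as′ b′ * n + n               ≡⟨ +-comm (weight as′ b′ * n) n ⟩
  suc (weight as′ b′) * n             ≤⟨ *-monoˡ-≤ n w< ⟩
  weight as b * n                     ≤⟨ m≤m+n _ _ ⟩
  weight as b * n + steps b as        ≤⟨ bound ⟩
  fuel                                ∎
  where open ≤-Reasoning

-- The factor 16 consists of at most 15 operations in a round and the final addition of `k`.
iterate : ∀ n fuel {α} αs → α ≡ sum αs → All (0 <_) αs → length αs ≤ n → Bounded n fuel αs → Computes α αs (16 * fuel)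
iterate n fuel    αs α≡ pos len bound with initLast αs
iterate n fuel    _  α≡ pos len bound | []             = _ , empty , refl , z≤n
iterate n fuel    _  α≡ pos len bound | [] ∷ʳ′ b       = _ , single , sym (𝒵-singleton b) , z≤n
iterate n zero    _  α≡ pos len bound | (a ∷ as) ∷ʳ′ b = contradiction (bound {a ∷ as} {b} refl) n≮0
iterate n (suc fuel) _ α≡ (0<a ∷ pos) len bound | (a ∷ as) ∷ʳ′ b =
  let pos-as , 0<b        = Allₚ.∷ʳ⁻ pos
      sound , cheap       = Rounds.sound-round _ a as b α≡ 0<a pos-as 0<b
      len′                = ≤-trans (shorter sound) len
      _ , it , val , cost = iterate n fuel _ (sum≡ sound) (positive sound) len′
                              (progress-bounded len′ (progress sound) (s≤s⁻¹ (bound {a ∷ as} {b} refl)))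
  in _ , repeat it , trans (cong (_+ _) val) (𝒵≡ sound)
   , ≤-trans (+-mono-≤ cheap (+-monoˡ-≤ 1 cost)) (≤-reflexive (regroup fuel))
  where
  regroup : ∀ x → 15 + (16 * x + 1) ≡ 16 * suc x
  regroup = solve-∀

value-total : ∀ αs → value (total αs) ≡ sum αs
value-total []       = refl
value-total (a ∷ αs) = cong (a +_) (value-total αs)

ops-total : ∀ αs → ops (total αs) ≡ length αs
ops-total []       = refl
ops-total (a ∷ αs) = trans (+-comm (ops (total αs)) 1) (cong suc (ops-total αs))

-- The fuel 2Bn + n comes from weight at most 2B and fewer than n steps. Adding n operations for the
-- initial sum gives 32Bn + 17n, and n ≤ Bn because a positive entry has at least one bit.
complexity : (α₁ : ℕ) (αs : List ℕ) (αₙ : ℕ) → All (0 <_) (α₁ ∷ (αs ∷ʳ αₙ)) →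
    ∃[ result ] (Algorithm (α₁ ∷ (αs ∷ʳ αₙ)) result
    × value result ≡ 𝒵 (α₁ ∷ (αs ∷ʳ αₙ))
    × ops result ≤ 49 * (bits (α₁ ∷ (αs ∷ʳ αₙ)) * length (α₁ ∷ (αs ∷ʳ αₙ))))
complexity a as b pos@(0<a ∷ _) with
  iterate n (2 * B * n + n) tuple (value-total tuple) pos ≤-refl bound
  where
  tuple : List ℕ
  tuple = a ∷ (as ∷ʳ b)
  n B : ℕ
  n = length tuple
  B = bits tuple
  bound : Bounded n (2 * B * n + n) tuple
  bound {as′} {b′} eq = +-mono-≤-< (*-monoˡ-≤ n (subst (λ l → weight as′ b′ ≤ 2 * bits l) (sym eq) (weight≤2bits as′ b′)))
    (≤-trans (s≤s (steps≤length b′ as′)) (≤-reflexive (trans (sym (length-∷ʳ as′ b′)) (cong length (sym eq)))))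
... | c , it , val , cost = _ , run it , val , (begin
  ops (total tuple) + ops c                ≤⟨ +-mono-≤ (≤-reflexive (ops-total tuple)) cost ⟩
  n + 16 * (2 * B * n + n)                 ≡⟨ regroup n B ⟩
  32 * (B * n) + 17 * n                    ≤⟨ +-monoʳ-≤ (32 * (B * n)) (*-monoʳ-≤ 17 n≤Bn) ⟩
  32 * (B * n) + 17 * (B * n)              ≡⟨ *-distribʳ-+ (B * n) 32 17 ⟨
  49 * (B * n)                             ∎)
  where
  open ≤-Reasoning
  tuple : List ℕ
  tuple = a ∷ (as ∷ʳ b)
  n B : ℕ
  n = length tuple
  B = bits tuple
  regroup : ∀ n B → n + 16 * (2 * B * n + n) ≡ 32 * (B * n) + 17 * n
  regroup = solve-∀
  n≤Bn : n ≤ B * n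
  n≤Bn = ≤-trans (≤-reflexive (sym (*-identityˡ n))) (*-monoˡ-≤ n (≤-trans (bitLength-positive 0<a) (m≤m+n (bitLength a) (bits (as ∷ʳ b)))))

theorem6p2 :
  ((α₁ : ℕ) (αs : List ℕ) (αₙ : ℕ) → All (0 <_) (α₁ ∷ (αs ∷ʳ αₙ)) →
    let α = sum (α₁ ∷ (αs ∷ʳ αₙ)) in
    𝒵 (α₁ ∷ (αs ∷ʳ αₙ)) ≡
      (if does (αₙ <? α₁) then
         𝒵 (αₙ ∷ (reverse αs ∷ʳ α₁))
       else if does (α₁ ≟ αₙ) then
         𝒵 αs + α₁
       else if does (α₁ <? αₙ) ∧ does (αₙ <? 2 * α₁) then
         𝒵 (removeZeros (ℛ α₁ (αₙ ∸ α₁) ∷ (αs ∷ʳ (αₙ ∸ α₁ + ℛ α₁ (αₙ ∸ α₁)))))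
       else if does (2 * α₁ ≟ αₙ) then
         𝒵 (αs ∷ʳ α₁)
       else if does (2 * α₁ <? αₙ) ∧ does (3 * αₙ <? 2 * α) then
         𝒵 (αs ++ α₁ ∷ (αₙ ∸ 2 * α₁) ∷ [])
       else if does ((2 * (α ∸ αₙ)) ∣? αₙ) then
         𝒵 (α₁ ∷ αs)
       else
         𝒵 (α₁ ∷ (αs ∷ʳ ℛ αₙ (2 * (α ∸ αₙ))))))
  ×
  (∃[ C ] ((α₁ : ℕ) (αs : List ℕ) (αₙ : ℕ) → All (0 <_) (α₁ ∷ (αs ∷ʳ αₙ)) →
    ∃[ result ] (Algorithm (α₁ ∷ (αs ∷ʳ αₙ)) result
      × value result ≡ 𝒵 (α₁ ∷ (αs ∷ʳ αₙ))
      × ops result ≤ C * (bits (α₁ ∷ (αs ∷ʳ αₙ)) * length (α₁ ∷ (αs ∷ʳ αₙ))))))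
theorem6p2 = (λ { a as b (0<a ∷ pos) → let open Cases a as b in
    if-dec (𝒵 tuple ≡_) (b <? a) (λ _ → reversed) λ _ →
    if-dec (𝒵 tuple ≡_) (a ≟ b) equal λ _ →
    if-dec (𝒵 tuple ≡_) ((a <? b) ×-dec (b <? 2 * a))
      -- Only the first entry can be zero: the last one is at least b - a > 0.
      (λ (a<b , _) → trans (remainder a<b)
        (sym (𝒵-removeZeros-∷ (ℛ a (b ∸ a)) (Allₚ.∷ʳ⁺ (proj₁ (Allₚ.∷ʳ⁻ pos)) (≤-trans (m<n⇒0<n∸m a<b) (m≤m+n _ _)))))) λ _ →
    if-dec (𝒵 tuple ≡_) (2 * a ≟ b) doubled λ _ →
    if-dec (𝒵 tuple ≡_) ((2 * a <? b) ×-dec (3 * b <? 2 * sum tuple)) (λ (2a<b , _) → rotated (<⇒≤ 2a<b)) λ _ →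
    if-dec (𝒵 tuple ≡_) (2 * (sum tuple ∸ b) ∣? b)
      (λ 2A∣b → lastRemoved 0<a (∣⇒ℛ≡0 (0<2sum-init 0<a) (subst (λ A → 2 * A ∣ b) sum-init 2A∣b)))
      (λ _ → trans (lastRemainder 0<a) (cong (λ A → 𝒵 (a ∷ (as ∷ʳ ℛ b (2 * A)))) (sym sum-init)))
    }) , 49 , complexity
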